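{- Let $m,n,p\ge 2$ and $k\ge3$. Suppose $\mathcal{F}_1,\dots,\mathcal{F}_k$, $\mathcal{G}_1,\dots,\mathcal{G}_k$, $\mathcal{H}_1,\dots,\mathcal{H}_k$ are families of pairwise almost orthogonal symmetric chain decompositions of $Q_m$, $Q_n$, $Q_p$ respectively, such that two of these three families are good and the remaining family is either good or belongs to an odd-dimensional hypercube. Then there exist $k$ pairwise almost orthogonal symmetric chain decompositions $\mathcal{D}_1,\dots,\mathcal{D}_k$ of $Q_{m+n+p}=Q_m\times Q_n\times Q_p$ such that for each $i$ every chain of $\mathcal{D}_i$ is contained in a cuboid $A\times B\times C$ with $A\in\mathcal{F}_i$, $B\in\mathcal{G}_i$, $C\in\mathcal{H}_i$.
   Context: $Q_n$ denotes the Boolean lattice of subsets of $[n]=\{1,\dots,n\}$ under inclusion; products of hypercubes (product order) are identified with the hypercube of the summed dimension. A symmetric chain in $Q_n$ consists of exactly one subset of each size $j,\dots,n-j$ for some $j$; a symmetric chain decomposition (SCD) is a partition into symmetric chains. Two SCDs $\mathcal{F},\mathcal{G}$ of $Q_n$ are almost orthogonal if for all chains $A\in\mathcal{F}$, $B\in\mathcal{G}$, $|A\cap B|\le1$, except when $A$ and $B$ both contain $\varnothing$ and $[n]$, in which case $|A\cap B|=2$. A collection $\{\mathcal{F}^j\}$ of pairwise almost orthogonal SCDs of $Q_n$ is good if either $n$ is even and the $1$-element chains occurring in the different $\mathcal{F}^j$ are pairwise distinct, or $n$ is odd and the graph whose vertex set is the union of all $2$-element chains of all $\mathcal{F}^j$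 and whose edges are these $2$-element chains admits an orientation in which every vertex has out-degree at most $1$. -}

module Defs where

open import Data.Nat using (ℕ; zero; suc; _+_; _*_; _≤_)
open import Data.Bool using (Bool)
import Data.Bool as Bool
open import Data.Fin using (Fin; toℕ)
open import Data.Fin.Subset using (Subset; _⊆_; ∣_∣) renaming (⊥ to ∅; ⊤ to full)
open import Data.Vec using (Vec; take; drop)
open import Data.Vec.Properties using (≡-dec)
open import Data.List using (List; []; _∷_; length; lookup; filter)
open import Data.List.Relation.Unary.All using (All)
open import Data.List.Relation.Unary.Linked using (Linked)
open import Data.List.Membership.Propositional using (_∈_)
import Data.List.Membership.DecPropositional as DecMem
open import Data.Maybe using (Maybe; just)
open import Data.Product using (Σ; ∃; _×_)
open import Data.Sum using (_⊎_)
open import Relation.Nullary using (¬_)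
open import Relation.Binary.PropositionalEquality using (_≡_; _≢_)
open import Relation.Binary.Definitions using (DecidableEquality)

-- Vertices of Q_n: subsets of [n], as characteristic vectors (stdlib Subset n = Vec Bool n).
_≟ˢ_ : ∀ {n} → DecidableEquality (Subset n)
_≟ˢ_ = ≡-dec Bool._≟_

-- A chain is listed in increasing order.
Chain : ℕ → Set
Chain n = List (Subset n)

-- Symmetric chain: consecutive members are nested, and for some j the members
-- have sizes exactly j, j+1, ..., n-j (one of each), i.e. length = n - 2j + 1.
IsSymChain : (n : ℕ) → Chain n → Set
IsSymChain n c =
  Linked _⊆_ c ×
  Σ ℕ λ j → (length c + 2 * j ≡ suc n) ×
            (∀ (i : Fin (length c)) → ∣ lookup c i ∣ ≡ j + toℕ i)

SCD : ℕ → Set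
SCD n = List (Chain n)

IsSCD : (n : ℕ) → SCD n → Set
IsSCD n F =
  All (IsSymChain n) F ×
  (∀ (s : Subset n) →
     Σ (Fin (length F)) (λ i → s ∈ lookup F i) ×
     (∀ (i i' : Fin (length F)) → s ∈ lookup F i → s ∈ lookup F i' → i ≡ i'))

-- |A ∩ B| for chains (chains have no repeated elements)
∣_∩_∣ : ∀ {n} → Chain n → Chain n → ℕ
∣ A ∩ B ∣ = length (filter (λ x → DecMem._∈?_ _≟ˢ_ x B) A)

BothFull : ∀ {n} → Chain n → Chain n → Set
BothFull A B = (∅ ∈ A × full ∈ A) × (∅ ∈ B × full ∈ B)

AlmostOrthogonal : ∀ {n} → SCD n → SCD n → Set
AlmostOrthogonal F G =
  ∀ A B → A ∈ F → B ∈ G →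
    (BothFull A B → ∣ A ∩ B ∣ ≡ 2) × (¬ BothFull A B → ∣ A ∩ B ∣ ≤ 1)

IsPAOFamily : (n k : ℕ) → (Fin k → SCD n) → Set
IsPAOFamily n k F =
  (∀ i → IsSCD n (F i)) × (∀ i j → i ≢ j → AlmostOrthogonal (F i) (F j))

Even Odd : ℕ → Set
Even n = Σ ℕ λ t → n ≡ 2 * t
Odd n = Σ ℕ λ t → n ≡ suc (2 * t)

IsEdge : ∀ {n k} → (Fin k → SCD n) → Subset n → Subset n → Set
IsEdge F a b = Σ _ λ i → ((a ∷ b ∷ []) ∈ F i) ⊎ ((b ∷ a ∷ []) ∈ F i)

-- Good collection.  For n odd: an orientation with out-degree ≤ 1 is encoded by
-- a partial "out-neighbour" map Out (each vertex has at most one out-edge),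
-- pointing only along edges, such that every edge is oriented one way.
Good : (n k : ℕ) → (Fin k → SCD n) → Set
Good n k F =
  (Even n ×
    (∀ i j → i ≢ j → ∀ A B → A ∈ F i → B ∈ F j →
       length A ≡ 1 → length B ≡ 1 → A ≢ B))
  ⊎
  (Odd n ×
    Σ (Subset n → Maybe (Subset n)) λ Out →
      (∀ a b → Out a ≡ just b → IsEdge F a b) ×
      (∀ i a b → (a ∷ b ∷ []) ∈ F i → (Out a ≡ just b) ⊎ (Out b ≡ just a)))

π₁ : ∀ {m n p} → Subset (m + n + p) → Subset m
π₁ {m} {n} s = take m (take (m + n) s)

π₂ : ∀ {m n p} → Subset (m + n + p) → Subset n
π₂ {m} {n} s = drop m (take (m + n) s)

π₃ : ∀ {m n p} → Subset (m + n + p) → Subset p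
π₃ {m} {n} s = drop (m + n) s

InCuboid : ∀ {m n p} → Chain (m + n + p) → Chain m → Chain n → Chain p → Set
InCuboid {m} {n} {p} D A B C =
  All (λ s → (π₁ {m} {n} {p} s ∈ A) × (π₂ {m} {n} {p} s ∈ B) × (π₃ {m} {n} {p} s ∈ C)) D

{-# OPTIONS --safe #-}
module Submission where

-- Every box A × B × C of chains, one from each of the i-th decompositions, is cut into symmetric chains
-- separately.  Two members common to a chain of D_i and a chain of D_j (i ≠ j) have, by almost
-- orthogonality of the factors, coordinates that agree or jump from ∅ to the full set of the factor.  So
-- the boxes are cut such that no chain contains a jump in one or two coordinates (all three: ∅ and the
-- full set), with exceptions only if the remaining chains are tiny: for one jump both have at most two
-- elements, for two jumps the third is a singleton.  Parity and goodness exclude that D_i and D_j have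
-- the same exception: singletons of a good family are distinct, and for two 2-element chains the
-- exception is placed at the tail of the oriented edge.
--
-- The cuts start from the hooks {x_t} × [y_0, w_t] ∪ [x_t, z] × {w_t} of a product of two chains, whose end
-- pieces are exchanged so that no hook contains a jump.  With k ≥ 3 every factor has dimension at least 4
-- (a set with only two upper covers serves at most two decompositions), which leaves room for this.

open import Defs
open import Data.Bool using (true; false)
open import Data.Empty using (⊥; ⊥-elim)
open import Data.Fin using (Fin; zero; suc; toℕ)
import Data.Fin.Properties as Fin
open import Data.Fin.Subset using (Subset; _⊆_; ∣_∣) renaming (⊥ to ∅; ⊤ to ⊤ˢ)
open import Data.Fin.Subset.Properties using (p⊆q⇒∣p∣≤∣q∣; ∣⊥∣≡0; ∣⊤∣≡n; ∣p∣≤n; ⊆-refl; ⊆-trans; out⊆; s⊆s; drop-∷-⊆)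
open import Data.List using (List; []; _∷_; [_]; _++_; _∷ʳ_; map; concat; concatMap; filter; length; lookup; cartesianProduct; initLast; _∷ʳ′_)
open import Data.List.Properties using (map-++; ++-identityʳ; cartesianProductWith-zeroʳ; cartesianProductWith-distribʳ-++; concat-++; concat-map; concatMap-++; map-id; map-∘; length-++; length-map; ++-assoc)
open import Data.List.Membership.Propositional using (_∈_)
open import Data.List.Membership.Propositional.Properties using (∈-concat⁺′; ∈-concat⁻; ∈-cartesianProduct⁺; ∈-cartesianProduct⁻; ∈-map⁺; ∈-map⁻; ∈-++⁺ˡ; ∈-++⁺ʳ; ∈-lookup; ∈-filter⁺; ∈-filter⁻)
import Data.List.Membership.DecPropositional as DecMem
open import Data.List.Relation.Binary.Disjoint.Propositional using (Disjoint)
open import Data.List.Relation.Binary.Permutation.Propositional using (_↭_; ↭-refl; ↭-sym; ↭-trans; ↭-reflexive; ↭⇒↭ₛ; module PermutationReasoning)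
open import Data.List.Relation.Binary.Permutation.Propositional.Properties using (++⁺; ++⁺ˡ; ++⁺ʳ; ++-commutativeMonoid; ∈-resp-↭)
import Data.List.Relation.Binary.Permutation.Propositional.Properties as ↭
import Data.List.Relation.Binary.Permutation.Setoid.Properties as ↭ₛ
open import Data.List.Relation.Unary.All using (All; []; _∷_)
import Data.List.Relation.Unary.All as All
import Data.List.Relation.Unary.All.Properties as All
open import Data.List.Relation.Unary.AllPairs using (AllPairs; []; _∷_)
open import Data.List.Relation.Unary.Any using (Any; here; there; index)
open import Data.List.Relation.Unary.Any.Properties using (lookup-index)
open import Data.List.Relation.Unary.Linked using (Linked; []; [-]; _∷_)
open import Data.List.Relation.Unary.Unique.Propositional using (Unique)
import Data.List.Relation.Unary.Unique.Propositional.Properties as Unique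
open import Data.Maybe using (just)
open import Data.Maybe.Properties using (just-injective)
open import Data.Nat using (ℕ; zero; suc; _+_; _*_; _≤_; _<_; z≤n; s≤s)
open import Data.Nat.Properties
open import Data.Nat.Solver using (module +-*-Solver)
open import Data.Product using (Σ; ∃; ∃₂; _×_; _,_; proj₁; proj₂; swap; map₂)
open import Data.Sum using (_⊎_; inj₁; inj₂)
open import Data.Unit using (⊤)
import Data.Vec as Vec
import Data.Vec.Properties as Vec
open import Function using (_∘_; id)
open import Relation.Binary.Definitions using (tri<; tri≈; tri>)
open import Relation.Binary.PropositionalEquality using (_≡_; _≢_; refl; sym; trans; cong; cong₂; subst; setoid; module ≡-Reasoning)
open import Relation.Nullary using (¬_; Dec; yes; no)
open import Relation.Nullary.Decidable using (_×-dec_)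
import Algebra.Solver.CommutativeMonoid as CMSolver

-- Graded orders and decompositions into symmetric paths

-- The exceptions are forced. If one chain of a box is full and the other two have at most two
-- members each, every cut into symmetric chains contains a run through the whole full chain over
-- some fixed pair of the other two. If one factor is a singleton, the chain joining the lowest and
-- the highest point of the box is a double jump. Only the place of an exception can be chosen: with
-- two 2-element factors the run can be put over a prescribed member of either one. The orientation
-- prescribes that member, but D_i and D_j must also consult the same factor. Hence the three
-- families carry distinct priorities, and a family known only to live in odd dimension comes last,
-- so that its orientation is never asked for. The delicate box is a 2-element chain times two full
-- chains, where no exception is allowed. The 2-element chain and one full chain form a path whose
-- last but one point ends a jump, and an exchange between only two hooks leaves this jump intact;
-- this is what calls for three hooks.

record Graded : Set₁ where
  infix 4 _⋖_
  field
    Carrier : Set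
    _⋖_     : Carrier → Carrier → Set
    rank    : Carrier → ℕ
    rank-⋖  : ∀ {x y} → x ⋖ y → rank y ≡ suc (rank x)

open Graded public using (Carrier)

module _ (G : Graded) where
  open Graded G hiding (Carrier)

  data Path : Carrier G → Carrier G → List (Carrier G) → Set where
    [-] : ∀ {x} → Path x x [ x ]
    _∷_ : ∀ {x y z c} → x ⋖ y → Path y z c → Path x z (x ∷ c)

module _ {G : Graded} where
  open Graded G hiding (Carrier)

  infixr 5 _⟨_⟩_
  _⟨_⟩_ : ∀ {x z u w c d} → Path G x z c → z ⋖ u → Path G u w d → Path G x w (c ++ d)
  [-]     ⟨ e ⟩ q = e ∷ q
  (f ∷ p) ⟨ e ⟩ q = f ∷ (p ⟨ e ⟩ q)

  head-∈ : ∀ {x z c} → Path G x z c → x ∈ c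
  head-∈ [-]     = here refl
  head-∈ (_ ∷ _) = here refl

  last-∈ : ∀ {x z c} → Path G x z c → z ∈ c
  last-∈ [-]     = here refl
  last-∈ (_ ∷ p) = there (last-∈ p)

  path-head : ∀ {x z u c} → Path G x z (u ∷ c) → x ≡ u
  path-head [-]     = refl
  path-head (_ ∷ _) = refl

  path-last : ∀ {x z w} c → Path G x z (c ∷ʳ w) → z ≡ w
  path-last []      [-]     = refl
  path-last (_ ∷ [])    (_ ∷ p) = path-last [] p
  path-last (_ ∷ v ∷ c) (_ ∷ p) = path-last (v ∷ c) p

  path-tail : ∀ {x z u} c {w} → Path G x z (u ∷ (c ∷ʳ w)) → ∃ λ y → x ⋖ y × Path G y z (c ∷ʳ w)
  path-tail []      (e ∷ p) = _ , e , p
  path-tail (_ ∷ _) (e ∷ p) = _ , e , p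

  path-init : ∀ {x z u w} c → Path G x z (u ∷ (c ∷ʳ w)) → ∃ λ y → Path G x y (u ∷ c) × y ⋖ w
  path-init []      (e ∷ [-])     = _ , [-] , e
  path-init (v ∷ c) (e ∷ p) with path-init c p
  ... | y , q , f with path-head q
  ... | refl = y , e ∷ q , f

  rank-≥ : ∀ {x z c} → Path G x z c → All (λ u → rank x ≤ rank u) c
  rank-≥ [-]     = ≤-refl ∷ []
  rank-≥ (e ∷ p) =
    ≤-refl ∷ All.map (≤-trans (≤-trans (n≤1+n _) (≤-reflexive (sym (rank-⋖ e))))) (rank-≥ p)

  rank-< : ∀ {x y z c} → x ⋖ y → Path G y z c → All (λ u → rank x < rank u) c
  rank-< e p = All.map (≤-trans (≤-reflexive (sym (rank-⋖ e)))) (rank-≥ p)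

  rank-distinct : ∀ {x y} → rank x < rank y → x ≢ y
  rank-distinct lt refl = <-irrefl refl lt

  head≢tail : ∀ {x z u c} → Path G x z (u ∷ c) → All (u ≢_) c
  head≢tail [-]     = []
  head≢tail (e ∷ p) = All.map rank-distinct (rank-< e p)

  init≢last : ∀ {x z w} c → Path G x z (c ∷ʳ w) → All (_≢ w) c
  init≢last []      p       = []
  init≢last (u ∷ []) (e ∷ p) =
    rank-distinct (All.lookup (rank-< e p) (here refl)) ∷ []
  init≢last (u ∷ v ∷ c) (e ∷ p) =
    rank-distinct (All.lookup (rank-< e p) (∈-++⁺ʳ (v ∷ c) (here refl))) ∷ init≢last (v ∷ c) p

  path-length : ∀ {x z c} → Path G x z c → length c + rank x ≡ suc (rank z)
  path-length [-]     = refl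
  path-length (_∷_ {c = c} e p) =
    trans (sym (trans (cong (length c +_) (rank-⋖ e)) (+-suc _ _))) (path-length p)

map-path : ∀ {G H : Graded} (f : Carrier G → Carrier H) →
           (∀ {x y} → Graded._⋖_ G x y → Graded._⋖_ H (f x) (f y)) →
           ∀ {x z c} → Path G x z c → Path H (f x) (f z) (map f c)
map-path f f-⋖ [-]     = [-]
map-path f f-⋖ (e ∷ p) = f-⋖ e ∷ map-path f f-⋖ p

-- Ranks rise by exactly one along a path, so symmetry leaves only a condition on the sum of the two
-- end ranks.
record Sym (G : Graded) (N : ℕ) (c : List (Carrier G)) : Set where
  constructor symmetric
  field
    {bot top} : Carrier G
    path      : Path G bot top c
    balanced  : Graded.rank G bot + Graded.rank G top ≡ N

Pairs : {X : Set} → (X → X → Set) → List X → Set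
Pairs Ψ c = ∀ {P Q} → P ∈ c → Q ∈ c → Ψ P Q

-- The permutation expresses covering and disjointness at once and is stable under concatenation,
-- maps and products. `Ψ` is asked of pairs in both orders because a jump has a direction.
Decomp : (G : Graded) (N : ℕ) (Ψ : Carrier G → Carrier G → Set) → List (Carrier G) → Set
Decomp G N Ψ L = ∃ λ 𝓓 → concat 𝓓 ↭ L × All (λ D → Sym G N D × Pairs Ψ D) 𝓓

chain-⊆ : {X : Set} {L D : List X} (𝓓 : List (List X)) → concat 𝓓 ↭ L → D ∈ 𝓓 → ∀ {P} → P ∈ D → P ∈ L
chain-⊆ 𝓓 p D∈ P∈ = ∈-resp-↭ p (∈-concat⁺′ P∈ D∈)

module _ {G : Graded} {N : ℕ} where

  decomp-single : ∀ {Ψ c} → Sym G N c → Pairs Ψ c → Decomp G N Ψ c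
  decomp-single {c = c} s ψ = [ c ] , ↭-reflexive (++-identityʳ c) , (s , ψ) ∷ []

  infixr 5 _decomp-++_
  _decomp-++_ : ∀ {Ψ L L′} → Decomp G N Ψ L → Decomp G N Ψ L′ → Decomp G N Ψ (L ++ L′)
  (𝓓 , p , a) decomp-++ (𝓓′ , p′ , a′) =
    𝓓 ++ 𝓓′ , ↭-trans (↭-reflexive (sym (concat-++ 𝓓 𝓓′))) (++⁺ p p′) , All.++⁺ a a′

  decomp-↭ : ∀ {Ψ L L′} → L ↭ L′ → Decomp G N Ψ L → Decomp G N Ψ L′
  decomp-↭ q (𝓓 , p , a) = 𝓓 , ↭-trans p q , a

  decomp-mono : ∀ {Φ Ψ L} → (∀ {P Q} → P ∈ L → Q ∈ L → Φ P Q → Ψ P Q) →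
                Decomp G N Φ L → Decomp G N Ψ L
  decomp-mono f (𝓓 , p , a) = 𝓓 , p , All.tabulate λ D∈ →
    let s , φ = All.lookup a D∈ in
    s , λ P∈ Q∈ → f (chain-⊆ 𝓓 p D∈ P∈) (chain-⊆ 𝓓 p D∈ Q∈) (φ P∈ Q∈)

decomp-map : ∀ {G H N Ψ L L′} (f : Carrier G → Carrier H) →
             (∀ {x y} → Graded._⋖_ G x y → Graded._⋖_ H (f x) (f y)) →
             (∀ x → Graded.rank H (f x) ≡ Graded.rank G x) →
             map f L ↭ L′ →
             Decomp G N (λ P Q → Ψ (f P) (f Q)) L → Decomp H N Ψ L′
decomp-map {G} {H} {N} {Ψ} f f-⋖ f-rank q (𝓓 , p , a) =
  map (map f) 𝓓 ,
  ↭-trans (↭-reflexive (concat-map 𝓓)) (↭-trans (↭.map⁺ f p) q) ,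
  All.map⁺ (All.map image a)
  where
  image : ∀ {D} → Sym G N D × Pairs (λ P Q → Ψ (f P) (f Q)) D → Sym H N (map f D) × Pairs Ψ (map f D)
  image (symmetric pa b , ψ) =
    symmetric (map-path f f-⋖ pa) (trans (cong₂ _+_ (f-rank _) (f-rank _)) b) ,
    λ P∈ Q∈ → pairs (∈-map⁻ f P∈) (∈-map⁻ f Q∈)
    where
    pairs : ∀ {P Q} → (∃ λ x → x ∈ _ × P ≡ f x) → (∃ λ x → x ∈ _ × Q ≡ f x) → Ψ P Q
    pairs (_ , x∈ , refl) (_ , y∈ , refl) = ψ x∈ y∈

gather : {X Y : Set} (g : X → List Y) (Q : X → List Y → Set) (L : List X) →
         (∀ {x} → x ∈ L → ∃ λ 𝓓 → concat 𝓓 ↭ g x × All (Q x) 𝓓) →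
         ∃ λ 𝓓 → concat 𝓓 ↭ concatMap g L × All (λ D → ∃ λ x → x ∈ L × Q x D) 𝓓
gather g Q []      f = [] , ↭-refl , []
gather g Q (x ∷ L) f with f (here refl) | gather g Q L (f ∘ there)
... | 𝓓 , p , a | 𝓓′ , p′ , a′ =
  𝓓 ++ 𝓓′ , ↭-trans (↭-reflexive (sym (concat-++ 𝓓 𝓓′))) (++⁺ p p′) ,
  All.++⁺ (All.map (λ q → x , here refl , q) a)
          (All.map (λ { (x′ , x′∈ , q) → x′ , there x′∈ , q }) a′)

infixr 6 _⊗_
module _ (G H : Graded) where
  private
    module G = Graded G
    module H = Graded H

  data Cover : Carrier G × Carrier H → Carrier G × Carrier H → Set where
    left  : ∀ {x x′ y} → x G.⋖ x′ → Cover (x , y) (x′ , y)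
    right : ∀ {x y y′} → y H.⋖ y′ → Cover (x , y) (x , y′)

  rank-Cover : ∀ {P Q} → Cover P Q →
               G.rank (proj₁ Q) + H.rank (proj₂ Q) ≡ suc (G.rank (proj₁ P) + H.rank (proj₂ P))
  rank-Cover (left e)  = cong (_+ _) (G.rank-⋖ e)
  rank-Cover (right e) = trans (cong (_ +_) (H.rank-⋖ e)) (+-suc _ _)

_⊗_ : Graded → Graded → Graded
G ⊗ H = record
  { Carrier = Carrier G × Carrier H
  ; _⋖_     = Cover G H
  ; rank    = λ { (x , y) → Graded.rank G x + Graded.rank H y }
  ; rank-⋖  = rank-Cover G H
  }

-- Decompositions of a product of two paths

infixr 7 _⊠_
_⊠_ : {X Y : Set} → List X → List Y → List (X × Y)
_⊠_ = cartesianProduct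

col : {X Y : Set} → X → List Y → List (X × Y)
col x = map (x ,_)

row : {X Y : Set} → List X → Y → List (X × Y)
row A y = map (_, y) A

module _ {X : Set} where
  open CMSolver (++-commutativeMonoid {A = X}) public using () renaming (solve to ↭-solve; _⊕_ to _⊕_; _⊜_ to _⊜_)

⊠-distribˡ-++ : {X Y : Set} (A : List X) (C C′ : List Y) → A ⊠ (C ++ C′) ↭ A ⊠ C ++ A ⊠ C′
⊠-distribˡ-++ []      C C′ = ↭-refl
⊠-distribˡ-++ (x ∷ A) C C′ = begin
  col x (C ++ C′) ++ A ⊠ (C ++ C′)
    ↭⟨ ++⁺ (↭-reflexive (map-++ (x ,_) C C′)) (⊠-distribˡ-++ A C C′) ⟩
  (col x C ++ col x C′) ++ A ⊠ C ++ A ⊠ C′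
    ↭⟨ ↭-solve 4 (λ a b c d → (a ⊕ b) ⊕ (c ⊕ d) ⊜ (a ⊕ c) ⊕ (b ⊕ d)) ↭-refl (col x C) (col x C′) (A ⊠ C) (A ⊠ C′) ⟩
  (col x C ++ A ⊠ C) ++ col x C′ ++ A ⊠ C′ ∎
  where open PermutationReasoning

⊠-[] : {X Y : Set} (A : List X) (y : Y) → A ⊠ [ y ] ≡ row A y
⊠-[] []      y = refl
⊠-[] (x ∷ A) y = cong ((x , y) ∷_) (⊠-[] A y)

⊠-hook : {X Y : Set} (x : X) (A : List X) (C : List Y) (w : Y) →
         (x ∷ A) ⊠ (C ∷ʳ w) ↭ col x C ++ row (x ∷ A) w ++ A ⊠ C
⊠-hook x A C w = begin
  (x ∷ A) ⊠ (C ∷ʳ w)                      ↭⟨ ⊠-distribˡ-++ (x ∷ A) C [ w ] ⟩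
  (x ∷ A) ⊠ C ++ (x ∷ A) ⊠ [ w ]          ≡⟨ cong ((x ∷ A) ⊠ C ++_) (⊠-[] (x ∷ A) w) ⟩
  (col x C ++ A ⊠ C) ++ row (x ∷ A) w
    ↭⟨ ↭-solve 3 (λ a b c → (a ⊕ b) ⊕ c ⊜ a ⊕ (c ⊕ b)) ↭-refl (col x C) (A ⊠ C) (row (x ∷ A) w) ⟩
  col x C ++ row (x ∷ A) w ++ A ⊠ C ∎
  where open PermutationReasoning

module _ {G H : Graded} where
  open Graded G using () renaming (rank to rankᴳ; rank-⋖ to rankᴳ-⋖)
  open Graded H using () renaming (rank to rankᴴ; rank-⋖ to rankᴴ-⋖)

  row-path : ∀ {x z A} y → Path G x z A → Path (G ⊗ H) (x , y) (z , y) (row A y)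
  row-path y = map-path (_, y) left

  col-path : ∀ {y w C} x → Path H y w C → Path (G ⊗ H) (x , y) (x , w) (col x C)
  col-path x = map-path (x ,_) right

  -- The outer hook joins the lowest to the highest corner. The remaining grid lacks the first point
  -- of `A` and the last point of `C`: its lowest rank is one larger, its highest rank one smaller,
  -- and the sum is again `N`.
  hooks : ∀ {N x z A y w C} → Path G x z A → Path H y w C →
          (rankᴳ x + rankᴴ y) + (rankᴳ z + rankᴴ w) ≡ N →
          Decomp (G ⊗ H) N (λ _ _ → ⊤) (A ⊠ C)
  hooks {C = C} ([-] {x}) q b =
    decomp-↭ (↭-reflexive (sym (++-identityʳ (col x C)))) (decomp-single (symmetric (col-path x q) b) _)
  hooks {C = y ∷ C₀} (_∷_ {x} {c = A} e p) q b with initLast C₀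
  hooks {C = y ∷ .[]} (_∷_ {x} {c = A} e p) [-] b | [] =
    decomp-↭ (↭-reflexive (sym (⊠-[] (x ∷ A) y))) (decomp-single (symmetric (row-path y (e ∷ p)) b) _)
  hooks {C = y ∷ .(C ∷ʳ w)} (_∷_ {x} {c = A} e p) q b | C ∷ʳ′ w with path-last (y ∷ C) q | path-init C q
  ... | refl | v , q′ , f =
    decomp-↭ (↭-trans (↭-reflexive shuffle) (↭-sym (⊠-hook x A (y ∷ C) w)))
      (decomp-single (symmetric (col-path x q ⟨ left e ⟩ row-path w p) b) _
       decomp-++ hooks p q′ (peel _ _ _ _ (rankᴳ-⋖ e) (rankᴴ-⋖ f) b))
    where
    shuffle : (col x ((y ∷ C) ∷ʳ w) ++ row A w) ++ A ⊠ (y ∷ C) ≡ col x (y ∷ C) ++ row (x ∷ A) w ++ A ⊠ (y ∷ C)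
    shuffle = trans (cong (λ h → (h ++ row A w) ++ A ⊠ (y ∷ C)) (map-++ (x ,_) (y ∷ C) [ w ]))
                (trans (cong (_++ A ⊠ (y ∷ C)) (++-assoc (col x (y ∷ C)) [ (x , w) ] (row A w)))
                   (++-assoc (col x (y ∷ C)) (row (x ∷ A) w) (A ⊠ (y ∷ C))))
    peel : ∀ {N a′ d} a b c d′ → a′ ≡ suc a → d ≡ suc d′ → (a + b) + (c + d) ≡ N → (a′ + b) + (c + d′) ≡ N
    peel a b c d′ refl refl s =
      trans (solve 4 (λ a b c d → ((con 1 :+ a) :+ b) :+ (c :+ d) := (a :+ b) :+ (c :+ (con 1 :+ d))) refl a b c d′) s
      where open +-*-Solver

-- Hooks with exchanged ends

snoc-view : {X : Set} (x : X) (A : List X) → ∃₂ λ A′ z → x ∷ A ≡ A′ ∷ʳ z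
snoc-view x []      = [] , x , refl
snoc-view x (y ∷ A) with snoc-view y A
... | A′ , z , eq = x ∷ A′ , z , cong (x ∷_) eq

ends-view : {X : Set} (A : List X) → 3 ≤ length A →
            ∃₂ λ x x′ → ∃₂ λ A′ z → A ≡ x ∷ x′ ∷ (A′ ∷ʳ z)
ends-view (_ ∷ []) (s≤s ())
ends-view (_ ∷ _ ∷ []) (s≤s (s≤s ()))
ends-view (x ∷ x′ ∷ x″ ∷ A) _ with snoc-view x″ A
... | A′ , z , eq = x , x′ , A′ , z , cong (λ B → x ∷ x′ ∷ B) eq

ends-view′ : {X : Set} (A : List X) → 3 ≤ length A →
             ∃₂ λ x A′ → ∃₂ λ z′ z → A ≡ x ∷ ((A′ ∷ʳ z′) ∷ʳ z)
ends-view′ (_ ∷ []) (s≤s ())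
ends-view′ (_ ∷ _ ∷ []) (s≤s (s≤s ()))
ends-view′ (x ∷ x′ ∷ x″ ∷ A) _ with snoc-view x″ A
... | A′ , z , eq with snoc-view x′ A′
...   | A″ , z′ , eq′ = x , A″ , z′ , z , cong (x ∷_) (trans (cong (x′ ∷_) eq) (cong (_∷ʳ z) eq′))

-- The pair of `(x , y)` and `(z , w)` has to stay allowed: if these are the corners of a grid, any
-- decomposition into symmetric chains joins them by one chain.
Apart : {X Y : Set} (x z : X) (y w : Y) → X × Y → X × Y → Set
Apart x z y w (a , c) (a′ , c′) =
  (a ≡ x → a′ ≡ z → c ≢ c′) × (c ≡ y → c′ ≡ w → a ≢ a′)

-- The three parts are kept apart because a third factor treats them differently. `side` and `spine`
-- are long enough to undergo another detour as paths; a simultaneous jump of both coordinates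
-- occurs only on the `spine`, between its own ends; the block is a smaller grid that has lost one
-- end of either path.
record Detour (G H : Graded) (N : ℕ) (x z : Carrier G) (A : List (Carrier G))
              (y w : Carrier H) (C : List (Carrier H)) : Set where
  field
    side spine     : List (Carrier G × Carrier H)
    blockˡ         : List (Carrier G)
    blockʳ         : List (Carrier H)
    partition      : side ++ spine ++ blockˡ ⊠ blockʳ ↭ A ⊠ C
    {side₀ side₁}  : Carrier G × Carrier H
    side-path      : Path (G ⊗ H) side₀ side₁ side
    side-balanced  : Graded.rank (G ⊗ H) side₀ + Graded.rank (G ⊗ H) side₁ ≡ N
    side-long      : 3 ≤ length side
    side-apart     : Pairs (Apart x z y w) side
    side-no-bottom : All (λ P → proj₂ P ≢ y) side
    spine-path     : Path (G ⊗ H) (x , y) (z , w) spine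
    spine-balanced : Graded.rank (G ⊗ H) (x , y) + Graded.rank (G ⊗ H) (z , w) ≡ N
    spine-long     : 3 ≤ length spine
    spine-apart    : Pairs (Apart x z y w) spine
    {x₂}           : Carrier G
    blockˡ-path    : Path G x₂ z blockˡ
    blockˡ-length  : 2 + length blockˡ ≡ length A
    blockˡ-≢       : All (x ≢_) blockˡ
    {w₂}           : Carrier H
    blockʳ-path    : Path H y w₂ blockʳ
    blockʳ-≢       : All (_≢ w) blockʳ
    block-balanced : Graded.rank (G ⊗ H) (x₂ , y) + Graded.rank (G ⊗ H) (z , w₂) ≡ N

module _ {G H : Graded} where
  open Graded G using () renaming (rank to rankᴳ; rank-⋖ to rankᴳ-⋖)
  open Graded H using () renaming (rank to rankᴴ; rank-⋖ to rankᴴ-⋖)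

  -- The first two hooks of A ⊠ C exchange their end points, which breaks up the end-to-end runs.
  detour : ∀ {N x z A y w C} → Path G x z A → Path H y w C → 3 ≤ length A → 3 ≤ length C →
           (rankᴳ x + rankᴴ y) + (rankᴳ z + rankᴴ w) ≡ N → Detour G H N x z A y w C
  detour {A = A} {C = C} p q lA lC b with ends-view A lA | ends-view′ C lC
  detour {N} {x} {z} {y = y} {w} (_∷_ {y = x₁} e₁ p₁) q lA lC b
    | .x , x₁′ , A₃ , z₀ , refl | y₀ , C₃ , w₁ , w₀ , refl
    with path-head p₁ | path-head q | path-last (x ∷ x₁′ ∷ A₃) (e₁ ∷ p₁) | path-last (y₀ ∷ (C₃ ∷ʳ w₁)) q
       | path-tail A₃ p₁ | path-init A₃ p₁ | path-tail (C₃ ∷ʳ w₁) q | path-init (C₃ ∷ʳ w₁) q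
  ... | refl | refl | refl | refl | x₂ , e₂ , p₂ | z₁ , pᵢ , f₁ | y₁ , g₁ , q₁ | w₁′ , q₂ , h₁
    with path-last (y ∷ C₃) q₂ | path-init C₃ q₂
  ... | refl | w₂ , q₃ , h₂ = record
    { side           = E
    ; spine          = M
    ; blockˡ         = A₃ ∷ʳ z
    ; blockʳ         = y ∷ C₃
    ; partition      = ↭-sym partition
    ; side-path      = col-path x q₁ ⟨ left e₁ ⟩ row-path w pᵢ
    ; side-balanced  = arith₁ (rankᴳ x) (rankᴴ y) (rankᴳ z₁) (rankᴴ w) (rankᴴ-⋖ g₁) (rankᴳ-⋖ f₁) b
    ; side-long      = long₁ C₃
    -- Without its two corners the outer hook never reaches `z` in the first coordinate nor `y` in
    -- the second.
    ; side-apart     = λ P∈ Q∈ → (λ _ a → ⊥-elim (All.lookup E-fst Q∈ a)) , (λ c → ⊥-elim (All.lookup E-snd P∈ c))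
    ; side-no-bottom = E-snd
    ; spine-path     = left e₁ ∷ (col-path x₁ q₂ ⟨ left e₂ ⟩ row-path w₁ p₂ ⟨ right h₁ ⟩ [-])
    ; spine-balanced = b
    ; spine-long     = long₂ C₃
    -- The only point of the spine over `x` is `(x , y)`, the only one at height `w` is `(z , w)`,
    -- and `(z , y)` is not on it.
    ; spine-apart    = λ P∈ Q∈ →
        (λ a a′ c → All.lookup M₂ Q∈ a′ (trans (sym c) (All.lookup M₁ P∈ a))) ,
        (λ c c′ a → All.lookup M₂ P∈ (trans a (All.lookup M₃ Q∈ c′)) c)
    ; blockˡ-path    = p₂
    ; blockˡ-length  = refl
    ; blockˡ-≢       = All.tail x≢
    ; blockʳ-path    = q₃
    ; blockʳ-≢       = All.++⁻ˡ (y ∷ C₃) ≢w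
    ; block-balanced = arith₂ (rankᴳ x) (rankᴴ y) (rankᴳ z) (rankᴴ w₂) (trans (rankᴳ-⋖ e₂) (cong suc (rankᴳ-⋖ e₁))) (trans (rankᴴ-⋖ h₁) (cong suc (rankᴴ-⋖ h₂))) b
    }
    where
    E = col x ((C₃ ∷ʳ w₁) ∷ʳ w) ++ row (x₁ ∷ A₃) w
    M = (x , y) ∷ col x₁ ((y ∷ C₃) ∷ʳ w₁) ++ row (A₃ ∷ʳ z) w₁ ++ [ (z , w) ]

    x≢ : All (x ≢_) (x₁ ∷ (A₃ ∷ʳ z))
    x≢ = head≢tail (e₁ ∷ p₁)
    ≢z : All (_≢ z) (x ∷ x₁ ∷ A₃)
    ≢z = init≢last (x ∷ x₁ ∷ A₃) (e₁ ∷ p₁)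
    y≢ : All (y ≢_) ((C₃ ∷ʳ w₁) ∷ʳ w)
    y≢ = head≢tail q
    ≢w : All (_≢ w) ((y ∷ C₃) ∷ʳ w₁)
    ≢w = init≢last (y ∷ (C₃ ∷ʳ w₁)) q
    y≢w₁ : y ≢ w₁
    y≢w₁ = All.lookup y≢ (∈-++⁺ˡ (∈-++⁺ʳ C₃ (here refl)))
    y≢w : y ≢ w
    y≢w = All.lookup y≢ (∈-++⁺ʳ (C₃ ∷ʳ w₁) (here refl))

    E-fst : All (λ P → proj₁ P ≢ z) E
    E-fst = All.++⁺ (All.map⁺ (All.universal (λ _ → All.head ≢z) _)) (All.map⁺ (All.tail ≢z))
    E-snd : All (λ P → proj₂ P ≢ y) E
    E-snd = All.++⁺ (All.map⁺ (All.map (_∘ sym) y≢)) (All.map⁺ (All.universal (λ _ → y≢w ∘ sym) _))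

    M₁ : All (λ P → proj₁ P ≡ x → proj₂ P ≡ y) M
    M₁ = (λ _ → refl) ∷ All.++⁺ (All.map⁺ {xs = y ∷ (C₃ ∷ʳ w₁)} (All.universal (λ _ a → ⊥-elim (All.head x≢ (sym a))) _))
      (All.++⁺ (All.map⁺ {xs = A₃ ∷ʳ z} (All.map (λ x≢u a → ⊥-elim (x≢u (sym a))) (All.tail x≢)))
        ((λ a → ⊥-elim (All.head ≢z (sym a))) ∷ []))
    M₂ : All (λ P → proj₁ P ≡ z → proj₂ P ≢ y) M
    M₂ = (λ a → ⊥-elim (All.head ≢z a)) ∷ All.++⁺ (All.map⁺ {xs = y ∷ (C₃ ∷ʳ w₁)} (All.universal (λ _ a → ⊥-elim (All.head (All.tail ≢z) a)) _))
      (All.++⁺ (All.map⁺ {xs = A₃ ∷ʳ z} (All.universal (λ _ _ → y≢w₁ ∘ sym) _)) ((λ _ → y≢w ∘ sym) ∷ []))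
    M₃ : All (λ P → proj₂ P ≡ w → proj₁ P ≡ z) M
    M₃ = (λ c → ⊥-elim (y≢w c)) ∷ All.++⁺ (All.map⁺ {xs = y ∷ (C₃ ∷ʳ w₁)} (All.map (λ u≢w c → ⊥-elim (u≢w c)) ≢w))
      (All.++⁺ (All.map⁺ {xs = A₃ ∷ʳ z} (All.universal (λ _ c → ⊥-elim (All.lookup ≢w (∈-++⁺ʳ (y ∷ C₃) (here refl)) c)) _))
        ((λ _ → refl) ∷ []))

    long₁ : ∀ C₃ → 3 ≤ length (col x ((C₃ ∷ʳ w₁) ∷ʳ w) ++ row (x₁ ∷ A₃) w)
    long₁ []       = s≤s (s≤s (s≤s z≤n))
    long₁ (_ ∷ C₃) = m≤n⇒m≤1+n (long₁ C₃)
    long₂ : ∀ C₃ → 3 ≤ length ((x , y) ∷ col x₁ ((y ∷ C₃) ∷ʳ w₁) ++ row (A₃ ∷ʳ z) w₁ ++ [ (z , w) ])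
    long₂ []       = s≤s (s≤s (s≤s z≤n))
    long₂ (_ ∷ C₃) = s≤s (s≤s (s≤s z≤n))

    arith₁ : ∀ {b′ c} a b c′ d → b′ ≡ suc b → c ≡ suc c′ → (a + b) + (c + d) ≡ N → (a + b′) + (c′ + d) ≡ N
    arith₁ a b c′ d refl refl s =
      trans (solve 4 (λ a b c d → (a :+ (con 1 :+ b)) :+ (c :+ d) := (a :+ b) :+ ((con 1 :+ c) :+ d)) refl a b c′ d) s
      where open +-*-Solver
    arith₂ : ∀ {a′ d} a b c d′ → a′ ≡ 2 + a → d ≡ 2 + d′ → (a + b) + (c + d) ≡ N → (a′ + b) + (c + d′) ≡ N
    arith₂ a b c d′ refl refl s =
      trans (solve 4 (λ a b c d → ((con 2 :+ a) :+ b) :+ (c :+ d) := (a :+ b) :+ (c :+ (con 2 :+ d))) refl a b c d′) s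
      where open +-*-Solver

    partition : (x ∷ x₁ ∷ (A₃ ∷ʳ z)) ⊠ (y ∷ ((C₃ ∷ʳ w₁) ∷ʳ w)) ↭ E ++ M ++ (A₃ ∷ʳ z) ⊠ (y ∷ C₃)
    partition = begin
      (x ∷ x₁ ∷ (A₃ ∷ʳ z)) ⊠ ((y ∷ (C₃ ∷ʳ w₁)) ∷ʳ w)
        ↭⟨ ⊠-hook x (x₁ ∷ (A₃ ∷ʳ z)) (y ∷ (C₃ ∷ʳ w₁)) w ⟩
      col x (y ∷ (C₃ ∷ʳ w₁)) ++ row (x ∷ x₁ ∷ (A₃ ∷ʳ z)) w ++ (x₁ ∷ (A₃ ∷ʳ z)) ⊠ ((y ∷ C₃) ∷ʳ w₁)
        ↭⟨ ++⁺ˡ (col x (y ∷ (C₃ ∷ʳ w₁))) (++⁺ˡ (row (x ∷ x₁ ∷ (A₃ ∷ʳ z)) w) (⊠-hook x₁ (A₃ ∷ʳ z) (y ∷ C₃) w₁)) ⟩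
      col x (y ∷ (C₃ ∷ʳ w₁)) ++ row (x ∷ x₁ ∷ (A₃ ∷ʳ z)) w ++ col x₁ (y ∷ C₃) ++ row (x₁ ∷ (A₃ ∷ʳ z)) w₁ ++ B
        ≡⟨ cong (λ r → col x (y ∷ (C₃ ∷ʳ w₁)) ++ ((x , w) ∷ (x₁ , w) ∷ r) ++ col x₁ (y ∷ C₃) ++ row (x₁ ∷ (A₃ ∷ʳ z)) w₁ ++ B) (map-++ (_, w) A₃ [ z ]) ⟩
      (xy ++ c₁) ++ (xw ++ (x₁w ++ (r₁ ++ zw))) ++ c₂ ++ (x₁w₁ ++ r₂) ++ B
        ↭⟨ ↭-solve 10 (λ xy c₁ xw x₁w r₁ zw c₂ x₁w₁ r₂ B → (xy ⊕ c₁) ⊕ (xw ⊕ (x₁w ⊕ (r₁ ⊕ zw))) ⊕ c₂ ⊕ (x₁w₁ ⊕ r₂) ⊕ B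
             ⊜ ((c₁ ⊕ xw) ⊕ (x₁w ⊕ r₁)) ⊕ (xy ⊕ ((c₂ ⊕ x₁w₁) ⊕ (r₂ ⊕ zw))) ⊕ B) ↭-refl xy c₁ xw x₁w r₁ zw c₂ x₁w₁ r₂ B ⟩
      ((c₁ ++ xw) ++ x₁w ++ r₁) ++ (xy ++ (c₂ ++ x₁w₁) ++ r₂ ++ zw) ++ B
        ≡⟨ cong₂ (λ s t → (s ++ x₁w ++ r₁) ++ (xy ++ t ++ r₂ ++ zw) ++ B)
             (sym (map-++ (x ,_) (C₃ ∷ʳ w₁) [ w ])) (sym (map-++ (x₁ ,_) (y ∷ C₃) [ w₁ ])) ⟩
      E ++ M ++ B ∎
      where
      open PermutationReasoning
      B = (A₃ ∷ʳ z) ⊠ (y ∷ C₃)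
      xy = [ (x , y) ]
      xw = [ (x , w) ]
      x₁w = [ (x₁ , w) ]
      zw = [ (z , w) ]
      x₁w₁ = [ (x₁ , w₁) ]
      c₁ = col x (C₃ ∷ʳ w₁)
      c₂ = col x₁ (y ∷ C₃)
      r₁ = row A₃ w
      r₂ = row (A₃ ∷ʳ z) w₁

-- Here `z` is meant to be the last but one point of the first path, followed by some `z₀`. A detour
-- of the prolonged path does not suffice: its outer hook, even without its corners, contains
-- `(x , w)` and `(z , w)`. The second clause also forbids the simultaneous jump, which is possible
-- because `(z , w)` is no longer the top corner of the grid.
Apart⁺ : {X Y : Set} (x z : X) (y w : Y) → X × Y → X × Y → Set
Apart⁺ x z y w P Q =
  Apart x z y w P Q × (proj₁ P ≡ x → proj₁ Q ≡ z → proj₂ P ≡ y → proj₂ Q ≢ w)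

init-view : {X : Set} (A : List X) → 4 ≤ length A →
            ∃₂ λ x x₁ → ∃₂ λ x₂ A′ → ∃ λ z → A ≡ x ∷ x₁ ∷ x₂ ∷ (A′ ∷ʳ z)
init-view (_ ∷ []) (s≤s ())
init-view (_ ∷ _ ∷ []) (s≤s (s≤s ()))
init-view (_ ∷ _ ∷ _ ∷ []) (s≤s (s≤s (s≤s ())))
init-view (x ∷ x₁ ∷ x₂ ∷ x₃ ∷ A) _ with snoc-view x₃ A
... | A′ , z , eq = x , x₁ , x₂ , A′ , z , cong (λ B → x ∷ x₁ ∷ x₂ ∷ B) eq

last-view : {X : Set} (A : List X) → 5 ≤ length A →
            ∃₂ λ x x₁ → ∃₂ λ A′ z₂ → ∃₂ λ z₁ z → A ≡ x ∷ x₁ ∷ (((A′ ∷ʳ z₂) ∷ʳ z₁) ∷ʳ z)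
last-view (_ ∷ []) (s≤s ())
last-view (_ ∷ _ ∷ []) (s≤s (s≤s ()))
last-view (_ ∷ _ ∷ _ ∷ []) (s≤s (s≤s (s≤s ())))
last-view (_ ∷ _ ∷ _ ∷ _ ∷ []) (s≤s (s≤s (s≤s (s≤s ()))))
last-view (x ∷ x₁ ∷ c₁ ∷ c₂ ∷ c₃ ∷ C) _ with snoc-view c₃ C
... | B , z , eq with snoc-view c₂ B
...   | B₁ , z₁ , eq₁ with snoc-view c₁ B₁
...     | A′ , z₂ , eq₂ = x , x₁ , A′ , z₂ , z₁ , z , cong (λ D → x ∷ x₁ ∷ D)
  (trans (cong (λ D → c₁ ∷ c₂ ∷ D) eq) (cong (_∷ʳ z) (trans (cong (c₁ ∷_) eq₁) (cong (_∷ʳ z₁) eq₂))))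

module _ {G H : Graded} where
  open Graded G using () renaming (rank to rankᴳ; rank-⋖ to rankᴳ-⋖; _⋖_ to _⋖ᴳ_)
  open Graded H using () renaming (rank to rankᴴ; rank-⋖ to rankᴴ-⋖)

  -- The first three hooks of (A ∷ʳ z₀) ⊠ C exchange their end pieces: the first one loses two points
  -- at either end, which extend the second and the third.
  braid : ∀ {N x z z₀ A y w C} → Path G x z A → z ⋖ᴳ z₀ → Path H y w C → 4 ≤ length A → 5 ≤ length C →
          (rankᴳ x + rankᴴ y) + (rankᴳ z₀ + rankᴴ w) ≡ N →
          Decomp (G ⊗ H) N (Apart⁺ x z y w) ((A ∷ʳ z₀) ⊠ C)
  braid {A = A} {C = C} p f q lA lC b with init-view A lA | last-view C lC
  braid {N} {x} {z} {z₀} {_} {y} {w} (e₁ ∷ e₂ ∷ p₂) f (g₁ ∷ q₁) lA lC b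
    | .x , x₁ , x₂ , A₄ , z₁ , refl | .y , y₁ , C₄ , w₂ , w₁ , w₀ , refl
    with path-head p₂ | path-head (e₂ ∷ p₂) | path-head q₁ | path-last (x ∷ x₁ ∷ x₂ ∷ A₄) (e₁ ∷ e₂ ∷ p₂)
       | path-last (y₁ ∷ ((C₄ ∷ʳ w₂) ∷ʳ w₁)) q₁
       | path-tail A₄ p₂ | path-init A₄ p₂ | path-tail ((C₄ ∷ʳ w₂) ∷ʳ w₁) q₁ | path-init ((C₄ ∷ʳ w₂) ∷ʳ w₁) q₁
  ... | refl | refl | refl | refl | refl | x₃ , e₃ , p₃ | z₂ , pᵢ , f₂ | y₂ , g₂ , q₂ | _ , t₁ , h₁
    with path-last (y₁ ∷ (C₄ ∷ʳ w₂)) t₁ | path-init (C₄ ∷ʳ w₂) t₁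
  ... | refl | _ , t₂ , h₂ with path-last (y₁ ∷ C₄) t₂ | path-init C₄ t₂
  ... | refl | w₃ , t₃ , h₃ = decomp-↭ (↭-sym partition)
    (decomp-single
       (symmetric (col-path x q₂ ⟨ left e₁ ⟩ row-path w (e₂ ∷ pᵢ))
         (shift 0 2 2 0 (rankᴳ x) (rankᴴ y) (rankᴳ z₂) (rankᴴ w) refl refl (rk₂ {H} g₁ g₂) (rk₂ {G} f₂ f) refl b))
       (λ P∈ Q∈ → ((λ _ a → ⊥-elim (All.lookup U-fst Q∈ a)) , (λ c → ⊥-elim (All.lookup U-snd P∈ c))) ,
                  (λ _ a → ⊥-elim (All.lookup U-fst Q∈ a)))
     decomp-++
     decomp-single
       (symmetric (left e₁ ∷ (col-path x₁ t₁ ⟨ left e₂ ⟩ row-path w₁ p₂ ⟨ right h₁ ⟩ [-]))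
         (shift 0 1 1 0 (rankᴳ x) (rankᴴ y) (rankᴳ z) (rankᴴ w) refl refl (rankᴴ-⋖ g₁) (rankᴳ-⋖ f) refl b))
       (λ P∈ Q∈ → ((λ a a′ c → All.lookup E₂ Q∈ a′ (trans (sym c) (All.lookup E₁ P∈ a))) ,
                   (λ c → ⊥-elim (All.lookup E-snd P∈ c))) ,
                  (λ _ _ c → ⊥-elim (All.lookup E-snd P∈ c)))
     decomp-++
     decomp-single
       (symmetric (left e₁ ∷ left e₂ ∷ (col-path x₂ (g₁ ∷ t₂) ⟨ left e₃ ⟩ row-path w₂ (p₃ ⟨ f ⟩ [-]) ⟨ right h₂ ⟩ right h₁ ∷ [-])) b)
       (λ P∈ Q∈ → ((λ a a′ c → All.lookup M₂ Q∈ (inj₁ a′) (trans (sym c) (All.lookup M₁ P∈ a))) ,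
                   (λ c c′ a → All.lookup M₂ P∈ (inj₂ (trans a (All.lookup M₃ Q∈ c′))) c)) ,
                  (λ _ a′ _ c′ → z≢z₀ (trans (sym a′) (All.lookup M₃ Q∈ c′))))
     decomp-++
     decomp-mono
       (λ P∈ Q∈ _ →
         let a≢x = λ a → All.lookup x≢₃ (proj₁ (∈-cartesianProduct⁻ ((A₄ ∷ʳ z) ∷ʳ z₀) (y ∷ y₁ ∷ C₄) P∈)) (sym a)
             c≢w = All.lookup ≢w₃ (proj₂ (∈-cartesianProduct⁻ ((A₄ ∷ʳ z) ∷ʳ z₀) (y ∷ y₁ ∷ C₄) Q∈)) in
         ((λ a → ⊥-elim (a≢x a)) , (λ _ c → ⊥-elim (c≢w c))) , (λ a → ⊥-elim (a≢x a)))
       (hooks (p₃ ⟨ f ⟩ [-]) (g₁ ∷ t₃)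
         (shift 3 0 0 3 (rankᴳ x) (rankᴴ y) (rankᴳ z₀) (rankᴴ w₃) refl (rk₃ {G} e₁ e₂ e₃) refl refl (rk₃ {H} h₃ h₂ h₁) b)))
    where
    A₃ = (A₄ ∷ʳ z) ∷ʳ z₀
    C₃ = (C₄ ∷ʳ w₂) ∷ʳ w₁
    -- `(z , w)` must leave the first hook because of `(x , w)`, and it fits on top of `(z , w₁)`.
    -- The second hook therefore hands `(z₀ , w₁)` on to the third; at the lower end it hands on
    -- `(x₁ , y)`, and starts with `(x , y₁)` instead.
    U = col x (C₃ ∷ʳ w) ++ row (x₁ ∷ x₂ ∷ A₄) w
    E = (x , y₁) ∷ col x₁ ((y₁ ∷ (C₄ ∷ʳ w₂)) ∷ʳ w₁) ++ row (x₂ ∷ (A₄ ∷ʳ z)) w₁ ++ [ (z , w) ]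
    M = (x , y) ∷ (x₁ , y) ∷ col x₂ ((y ∷ y₁ ∷ C₄) ∷ʳ w₂) ++ row A₃ w₂ ++ (z₀ , w₁) ∷ (z₀ , w) ∷ []

    rk₂ : ∀ {K : Graded} {u v t} → Graded._⋖_ K u v → Graded._⋖_ K v t → Graded.rank K t ≡ 2 + Graded.rank K u
    rk₂ {K} i j = trans (Graded.rank-⋖ K j) (cong suc (Graded.rank-⋖ K i))
    rk₃ : ∀ {K : Graded} {u v t s} → Graded._⋖_ K u v → Graded._⋖_ K v t → Graded._⋖_ K t s →
          Graded.rank K s ≡ 3 + Graded.rank K u
    rk₃ {K} i j k = trans (Graded.rank-⋖ K k) (cong suc (rk₂ {K} i j))

    shift : ∀ i j k l {a′ b′ c d} a b c′ d′ → i + j ≡ k + l → a′ ≡ i + a → b′ ≡ j + b → c ≡ k + c′ → d ≡ l + d′ →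
            (a + b) + (c + d) ≡ N → (a′ + b′) + (c′ + d′) ≡ N
    shift i j k l a b c′ d′ ij refl refl refl refl s = trans
      (trans (solve 6 (λ i j a b c d → ((i :+ a) :+ (j :+ b)) :+ (c :+ d) := (i :+ j) :+ ((a :+ b) :+ (c :+ d))) refl i j a b c′ d′)
        (trans (cong (_+ ((a + b) + (c′ + d′))) ij)
          (solve 6 (λ k l a b c d → (k :+ l) :+ ((a :+ b) :+ (c :+ d)) := (a :+ b) :+ ((k :+ c) :+ (l :+ d))) refl k l a b c′ d′))) s
      where open +-*-Solver

    p : Path G x z (x ∷ x₁ ∷ x₂ ∷ (A₄ ∷ʳ z))
    p = e₁ ∷ e₂ ∷ p₂
    x≢ : All (x ≢_) (x₁ ∷ x₂ ∷ A₃)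
    x≢ = head≢tail (p ⟨ f ⟩ [-])
    x≢₃ : All (x ≢_) A₃
    x≢₃ = All.tail (All.tail x≢)
    ≢z : All (_≢ z) (x ∷ x₁ ∷ x₂ ∷ A₄)
    ≢z = init≢last (x ∷ x₁ ∷ x₂ ∷ A₄) p
    ≢z₀ : All (_≢ z₀) (x ∷ x₁ ∷ x₂ ∷ (A₄ ∷ʳ z))
    ≢z₀ = init≢last (x ∷ x₁ ∷ x₂ ∷ (A₄ ∷ʳ z)) (p ⟨ f ⟩ [-])
    z≢z₀ : z ≢ z₀
    z≢z₀ = All.lookup ≢z₀ (∈-++⁺ʳ (x ∷ x₁ ∷ x₂ ∷ A₄) (here refl))
    y≢ : All (y ≢_) (y₁ ∷ (C₃ ∷ʳ w))
    y≢ = head≢tail (g₁ ∷ q₁)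
    y₁≢ : All (y₁ ≢_) (C₃ ∷ʳ w)
    y₁≢ = head≢tail q₁
    ≢w : All (_≢ w) (y ∷ y₁ ∷ C₃)
    ≢w = init≢last (y ∷ y₁ ∷ C₃) (g₁ ∷ q₁)
    ≢w₂ : All (_≢ w) (y ∷ y₁ ∷ (C₄ ∷ʳ w₂))
    ≢w₂ = All.++⁻ˡ (y ∷ y₁ ∷ (C₄ ∷ʳ w₂)) ≢w
    ≢w₃ : All (_≢ w) (y ∷ y₁ ∷ C₄)
    ≢w₃ = All.++⁻ˡ (y ∷ y₁ ∷ C₄) ≢w₂
    w₁∈ : w₁ ∈ C₃ ∷ʳ w
    w₁∈ = ∈-++⁺ˡ (∈-++⁺ʳ (C₄ ∷ʳ w₂) (here refl))
    w₂∈ : w₂ ∈ C₃ ∷ʳ w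
    w₂∈ = ∈-++⁺ˡ (∈-++⁺ˡ (∈-++⁺ʳ C₄ (here refl)))
    w∈ : w ∈ C₃ ∷ʳ w
    w∈ = ∈-++⁺ʳ C₃ (here refl)
    ≢y : ∀ {u} → u ∈ C₃ ∷ʳ w → u ≢ y
    ≢y u∈ u≡y = All.lookup (All.tail y≢) u∈ (sym u≡y)

    U-fst : All (λ P → proj₁ P ≢ z) U
    U-fst = All.++⁺ (All.map⁺ (All.universal (λ _ → All.head ≢z) (C₃ ∷ʳ w))) (All.map⁺ (All.tail ≢z))
    U-snd : All (λ P → proj₂ P ≢ y) U
    U-snd = All.++⁺ (All.map⁺ (All.tabulate ≢y)) (All.map⁺ (All.universal (λ _ → ≢y w∈) (x₁ ∷ x₂ ∷ A₄)))

    E-snd : All (λ P → proj₂ P ≢ y) E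
    E-snd = (All.head y≢ ∘ sym)
      ∷ All.++⁺ (All.map⁺ {xs = y₁ ∷ C₃} (All.map (_∘ sym) (All.++⁻ˡ (y₁ ∷ C₃) y≢)))
      (All.++⁺ (All.map⁺ (All.universal (λ _ → ≢y w₁∈) (x₂ ∷ (A₄ ∷ʳ z)))) (≢y w∈ ∷ []))
    E₁ : All (λ P → proj₁ P ≡ x → proj₂ P ≡ y₁) E
    E₁ = (λ _ → refl)
      ∷ All.++⁺ (All.map⁺ {xs = y₁ ∷ C₃} (All.universal (λ _ a → ⊥-elim (All.head x≢ (sym a))) _))
      (All.++⁺ (All.map⁺ (All.map (λ x≢u a → ⊥-elim (x≢u (sym a))) (All.++⁻ˡ (x₂ ∷ (A₄ ∷ʳ z)) (All.tail x≢))))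
        ((λ a → ⊥-elim (All.head ≢z (sym a))) ∷ []))
    E₂ : All (λ P → proj₁ P ≡ z → proj₂ P ≢ y₁) E
    E₂ = (λ a → ⊥-elim (All.head ≢z a))
      ∷ All.++⁺ (All.map⁺ {xs = y₁ ∷ C₃} (All.universal (λ _ a → ⊥-elim (All.head (All.tail ≢z) a)) _))
      (All.++⁺ (All.map⁺ (All.universal (λ _ _ c → All.lookup y₁≢ w₁∈ (sym c)) (x₂ ∷ (A₄ ∷ʳ z))))
        ((λ _ c → All.lookup y₁≢ w∈ (sym c)) ∷ []))

    M₁ : All (λ P → proj₁ P ≡ x → proj₂ P ≡ y) M
    M₁ = (λ _ → refl) ∷ (λ _ → refl)
      ∷ All.++⁺ (All.map⁺ {xs = y ∷ y₁ ∷ (C₄ ∷ʳ w₂)} (All.universal (λ _ a → ⊥-elim (All.head (All.tail x≢) (sym a))) _))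
      (All.++⁺ (All.map⁺ (All.map (λ x≢u a → ⊥-elim (x≢u (sym a))) x≢₃))
        ((λ a → ⊥-elim (All.head ≢z₀ (sym a))) ∷ (λ a → ⊥-elim (All.head ≢z₀ (sym a))) ∷ []))
    inner : ∀ {u} → u ≢ z → u ≢ z₀ → ∀ {v} → u ≡ z ⊎ u ≡ z₀ → v ≢ y
    inner n n₀ (inj₁ a) = ⊥-elim (n a)
    inner n n₀ (inj₂ a) = ⊥-elim (n₀ a)
    M₂ : All (λ P → proj₁ P ≡ z ⊎ proj₁ P ≡ z₀ → proj₂ P ≢ y) M
    M₂ = inner (All.head ≢z) (All.head ≢z₀) ∷ inner (All.head (All.tail ≢z)) (All.head (All.tail ≢z₀))
      ∷ All.++⁺ (All.map⁺ {xs = y ∷ y₁ ∷ (C₄ ∷ʳ w₂)}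
          (All.universal (λ _ → inner (All.head (All.tail (All.tail ≢z))) (All.head (All.tail (All.tail ≢z₀)))) _))
      (All.++⁺ (All.map⁺ (All.universal (λ _ _ → ≢y w₂∈) A₃)) ((λ _ → ≢y w₁∈) ∷ (λ _ → ≢y w∈) ∷ []))
    M₃ : All (λ P → proj₂ P ≡ w → proj₁ P ≡ z₀) M
    M₃ = (λ c → ⊥-elim (All.head ≢w c)) ∷ (λ c → ⊥-elim (All.head ≢w c))
      ∷ All.++⁺ (All.map⁺ {xs = y ∷ y₁ ∷ (C₄ ∷ʳ w₂)} (All.map (λ u≢w c → ⊥-elim (u≢w c)) ≢w₂))
      (All.++⁺ (All.map⁺ (All.universal (λ _ c → ⊥-elim (All.lookup ≢w₂ (∈-++⁺ʳ (y ∷ y₁ ∷ C₄) (here refl)) c)) A₃))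
        ((λ _ → refl) ∷ (λ _ → refl) ∷ []))

    partition : (x ∷ x₁ ∷ x₂ ∷ A₃) ⊠ (y ∷ y₁ ∷ (C₃ ∷ʳ w)) ↭ U ++ E ++ M ++ A₃ ⊠ (y ∷ y₁ ∷ C₄)
    partition = begin
      (x ∷ x₁ ∷ x₂ ∷ A₃) ⊠ ((y ∷ y₁ ∷ C₃) ∷ʳ w)
        ↭⟨ ⊠-hook x (x₁ ∷ x₂ ∷ A₃) (y ∷ y₁ ∷ C₃) w ⟩
      H₀ ++ R₀ ++ (x₁ ∷ x₂ ∷ A₃) ⊠ ((y ∷ y₁ ∷ (C₄ ∷ʳ w₂)) ∷ʳ w₁)
        ↭⟨ ++⁺ˡ H₀ (++⁺ˡ R₀ (⊠-hook x₁ (x₂ ∷ A₃) (y ∷ y₁ ∷ (C₄ ∷ʳ w₂)) w₁)) ⟩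
      H₀ ++ R₀ ++ H₁ ++ R₁ ++ (x₂ ∷ A₃) ⊠ ((y ∷ y₁ ∷ C₄) ∷ʳ w₂)
        ↭⟨ ++⁺ˡ H₀ (++⁺ˡ R₀ (++⁺ˡ H₁ (++⁺ˡ R₁ (⊠-hook x₂ A₃ (y ∷ y₁ ∷ C₄) w₂)))) ⟩
      H₀ ++ R₀ ++ H₁ ++ R₁ ++ c₂ ++ (x₂w₂ ++ r₂) ++ B
        ≡⟨ cong₂ (λ s t → H₀ ++ (xw ++ s) ++ H₁ ++ (x₁w₁ ++ t) ++ c₂ ++ (x₂w₂ ++ r₂) ++ B)
             (trans (map-++ (_, w) (x₁ ∷ x₂ ∷ (A₄ ∷ʳ z)) [ z₀ ]) (cong (_++ z₀w) (map-++ (_, w) (x₁ ∷ x₂ ∷ A₄) [ z ])))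
             (map-++ (_, w₁) (x₂ ∷ (A₄ ∷ʳ z)) [ z₀ ]) ⟩
      (xy ++ (xy₁ ++ c₀)) ++ (xw ++ ((r₀ ++ zw) ++ z₀w)) ++ (x₁y ++ c₁) ++ (x₁w₁ ++ (r₁ ++ z₀w₁)) ++ c₂ ++ (x₂w₂ ++ r₂) ++ B
        ↭⟨ ↭-solve 16 (λ xy xy₁ c₀ xw r₀ zw z₀w x₁y c₁ x₁w₁ r₁ z₀w₁ c₂ x₂w₂ r₂ B →
             (xy ⊕ (xy₁ ⊕ c₀)) ⊕ (xw ⊕ ((r₀ ⊕ zw) ⊕ z₀w)) ⊕ (x₁y ⊕ c₁) ⊕ (x₁w₁ ⊕ (r₁ ⊕ z₀w₁)) ⊕ c₂ ⊕ (x₂w₂ ⊕ r₂) ⊕ B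
             ⊜ ((c₀ ⊕ xw) ⊕ r₀) ⊕ (xy₁ ⊕ (c₁ ⊕ x₁w₁) ⊕ r₁ ⊕ zw) ⊕ (xy ⊕ x₁y ⊕ (c₂ ⊕ x₂w₂) ⊕ r₂ ⊕ z₀w₁ ⊕ z₀w) ⊕ B)
             ↭-refl xy xy₁ c₀ xw r₀ zw z₀w x₁y c₁ x₁w₁ r₁ z₀w₁ c₂ x₂w₂ r₂ B ⟩
      ((c₀ ++ xw) ++ r₀) ++ (xy₁ ++ (c₁ ++ x₁w₁) ++ r₁ ++ zw) ++ (xy ++ x₁y ++ (c₂ ++ x₂w₂) ++ r₂ ++ z₀w₁ ++ z₀w) ++ B
        ≡⟨ cong₂ (λ s t → (s ++ r₀) ++ (xy₁ ++ t ++ r₁ ++ zw) ++ (xy ++ x₁y ++ (c₂ ++ x₂w₂) ++ r₂ ++ z₀w₁ ++ z₀w) ++ B)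
             (sym (map-++ (x ,_) C₃ [ w ])) (sym (map-++ (x₁ ,_) (y₁ ∷ (C₄ ∷ʳ w₂)) [ w₁ ])) ⟩
      U ++ E ++ (xy ++ x₁y ++ (c₂ ++ x₂w₂) ++ r₂ ++ z₀w₁ ++ z₀w) ++ B
        ≡⟨ cong (λ s → U ++ E ++ (xy ++ x₁y ++ s ++ r₂ ++ z₀w₁ ++ z₀w) ++ B) (sym (map-++ (x₂ ,_) (y ∷ y₁ ∷ C₄) [ w₂ ])) ⟩
      U ++ E ++ M ++ B ∎
      where
      open PermutationReasoning
      B = A₃ ⊠ (y ∷ y₁ ∷ C₄)
      H₀ = col x (y ∷ y₁ ∷ C₃)
      R₀ = row (x ∷ x₁ ∷ x₂ ∷ A₃) w
      H₁ = col x₁ (y ∷ y₁ ∷ (C₄ ∷ʳ w₂))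
      R₁ = row (x₁ ∷ x₂ ∷ A₃) w₁
      xy = [ (x , y) ]
      xy₁ = [ (x , y₁) ]
      x₁y = [ (x₁ , y) ]
      xw = [ (x , w) ]
      zw = [ (z , w) ]
      z₀w = [ (z₀ , w) ]
      x₁w₁ = [ (x₁ , w₁) ]
      z₀w₁ = [ (z₀ , w₁) ]
      x₂w₂ = [ (x₂ , w₂) ]
      c₀ = col x C₃
      c₁ = col x₁ (y₁ ∷ (C₄ ∷ʳ w₂))
      c₂ = col x₂ (y ∷ y₁ ∷ C₄)
      r₀ = row (x₁ ∷ x₂ ∷ A₄) w
      r₁ = row (x₂ ∷ (A₄ ∷ʳ z)) w₁
      r₂ = row A₃ w₂

-- Decompositions of a product of three paths

⊠-congʳ : {X Y : Set} (A : List X) {L L′ : List Y} → L ↭ L′ → A ⊠ L ↭ A ⊠ L′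
⊠-congʳ []      p = ↭-refl
⊠-congʳ (x ∷ A) p = ++⁺ (↭.map⁺ (x ,_) p) (⊠-congʳ A p)

⊠-swap : {X Y : Set} (A : List X) (C : List Y) → map swap (A ⊠ C) ↭ C ⊠ A
⊠-swap []      C = ↭-reflexive (sym (cartesianProductWith-zeroʳ _,_ C))
⊠-swap (x ∷ A) C = begin
  map swap (col x C ++ A ⊠ C)          ≡⟨ map-++ swap (col x C) (A ⊠ C) ⟩
  map swap (col x C) ++ map swap (A ⊠ C)
    ↭⟨ ++⁺ (↭-reflexive (trans (sym (map-∘ C)) (sym (⊠-[] C x)))) (⊠-swap A C) ⟩
  C ⊠ [ x ] ++ C ⊠ A                   ↭⟨ ⊠-distribˡ-++ C [ x ] A ⟨
  C ⊠ (x ∷ A) ∎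
  where open PermutationReasoning

⊠-congˡ : {X Y : Set} {L L′ : List X} (C : List Y) → L ↭ L′ → L ⊠ C ↭ L′ ⊠ C
⊠-congˡ {L = L} {L′} C p = begin
  L ⊠ C            ↭⟨ ⊠-swap C L ⟨
  map swap (C ⊠ L) ↭⟨ ↭.map⁺ swap (⊠-congʳ C p) ⟩
  map swap (C ⊠ L′) ↭⟨ ⊠-swap C L′ ⟩
  L′ ⊠ C ∎
  where open PermutationReasoning

⊠-concatˡ : {X Y : Set} (𝓔 : List (List X)) (C : List Y) → concatMap (_⊠ C) 𝓔 ≡ concat 𝓔 ⊠ C
⊠-concatˡ []      C = refl
⊠-concatˡ (E ∷ 𝓔) C =
  trans (cong (E ⊠ C ++_) (⊠-concatˡ 𝓔 C)) (sym (cartesianProductWith-distribʳ-++ _,_ E (concat 𝓔) C))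

assoc : {X Y Z : Set} → (X × Y) × Z → X × (Y × Z)
assoc ((a , b) , c) = a , b , c

exchange : {X Y Z : Set} → Y × (X × Z) → X × (Y × Z)
exchange (b , a , c) = a , b , c

⊠-assoc : {X Y Z : Set} (A : List X) (B : List Y) (C : List Z) → map assoc ((A ⊠ B) ⊠ C) ≡ A ⊠ (B ⊠ C)
⊠-assoc []      B C = refl
⊠-assoc (x ∷ A) B C = begin
  map assoc ((col x B ++ A ⊠ B) ⊠ C)
    ≡⟨ cong (map assoc) (cartesianProductWith-distribʳ-++ _,_ (col x B) (A ⊠ B) C) ⟩
  map assoc (col x B ⊠ C ++ (A ⊠ B) ⊠ C)
    ≡⟨ map-++ assoc (col x B ⊠ C) _ ⟩
  map assoc (col x B ⊠ C) ++ map assoc ((A ⊠ B) ⊠ C)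
    ≡⟨ cong₂ _++_ (slice B) (⊠-assoc A B C) ⟩
  col x (B ⊠ C) ++ A ⊠ (B ⊠ C) ∎
  where
  open ≡-Reasoning
  slice : ∀ B → map assoc (col x B ⊠ C) ≡ col x (B ⊠ C)
  slice []      = refl
  slice (y ∷ B) = begin
    map assoc (col (x , y) C ++ col x B ⊠ C)           ≡⟨ map-++ assoc (col (x , y) C) _ ⟩
    map assoc (col (x , y) C) ++ map assoc (col x B ⊠ C)
      ≡⟨ cong₂ _++_ (trans (sym (map-∘ C)) (map-∘ C)) (slice B) ⟩
    col x (col y C) ++ col x (B ⊠ C)                   ≡⟨ sym (map-++ (x ,_) (col y C) _) ⟩
    col x (col y C ++ B ⊠ C) ∎

⊠-map₂ : {X Y Z : Set} (f : Y → Z) (A : List X) (L : List Y) → map (map₂ f) (A ⊠ L) ≡ A ⊠ map f L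
⊠-map₂ f []      L = refl
⊠-map₂ f (x ∷ A) L = trans (map-++ (map₂ f) (col x L) (A ⊠ L))
  (cong₂ _++_ (trans (sym (map-∘ L)) (map-∘ L)) (⊠-map₂ f A L))

⊠-exchange : {X Y Z : Set} (A : List X) (B : List Y) (C : List Z) →
             map exchange (B ⊠ (A ⊠ C)) ↭ A ⊠ (B ⊠ C)
⊠-exchange A B C = begin
  map exchange (B ⊠ (A ⊠ C))                  ≡⟨ cong (map exchange) (sym (⊠-assoc B A C)) ⟩
  map exchange (map assoc ((B ⊠ A) ⊠ C))      ≡⟨ sym (map-∘ ((B ⊠ A) ⊠ C)) ⟩
  map (λ P → exchange (assoc P)) ((B ⊠ A) ⊠ C) ≡⟨ flip-left (B ⊠ A) ⟩
  map assoc (map swap (B ⊠ A) ⊠ C)            ↭⟨ ↭.map⁺ assoc (⊠-congˡ C (⊠-swap B A)) ⟩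
  map assoc ((A ⊠ B) ⊠ C)                     ≡⟨ ⊠-assoc A B C ⟩
  A ⊠ (B ⊠ C) ∎
  where
  open PermutationReasoning
  flip-left : ∀ L → map (λ P → exchange (assoc P)) (L ⊠ C) ≡ map assoc (map swap L ⊠ C)
  flip-left []            = refl
  flip-left ((b , a) ∷ L) = trans (map-++ _ (col (b , a) C) (L ⊠ C))
    (trans (cong₂ _++_ (trans (sym (map-∘ C)) (map-∘ C)) (flip-left L)) (sym (map-++ assoc (col (a , b) C) _)))

⊠-exchangeʳ : {X Y Z : Set} (A : List X) (B : List Y) (C : List Z) →
              map (map₂ swap) (A ⊠ (C ⊠ B)) ↭ A ⊠ (B ⊠ C)
⊠-exchangeʳ A B C = ↭-trans (↭-reflexive (⊠-map₂ swap A (C ⊠ B))) (⊠-congʳ A (⊠-swap C B))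

module _ {G H K : Graded} {N : ℕ} {Ψ : Carrier (G ⊗ (H ⊗ K)) → Carrier (G ⊗ (H ⊗ K)) → Set} where
  private
    module G = Graded G
    module H = Graded H
    module K = Graded K

  assoc-⋖ : ∀ {P Q} → Cover (G ⊗ H) K P Q → Cover G (H ⊗ K) (assoc P) (assoc Q)
  assoc-⋖ (left (left e))  = left e
  assoc-⋖ (left (right e)) = right (left e)
  assoc-⋖ (right e)        = right (right e)

  decomp-assoc : ∀ {L L′} → map assoc L ↭ L′ →
                 Decomp ((G ⊗ H) ⊗ K) N (λ P Q → Ψ (assoc P) (assoc Q)) L → Decomp (G ⊗ (H ⊗ K)) N Ψ L′
  decomp-assoc = decomp-map assoc assoc-⋖ λ { ((a , b) , c) → sym (+-assoc (G.rank a) (H.rank b) (K.rank c)) }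

  decomp-exchange : ∀ A B C → Decomp (H ⊗ (G ⊗ K)) N (λ P Q → Ψ (exchange P) (exchange Q)) (B ⊠ (A ⊠ C)) →
                    Decomp (G ⊗ (H ⊗ K)) N Ψ (A ⊠ (B ⊠ C))
  decomp-exchange A B C = decomp-map exchange
    (λ { (left e) → right (left e) ; (right (left e)) → left e ; (right (right e)) → right (right e) })
    (λ { (b , a , c) → rank-exchange (G.rank a) (H.rank b) (K.rank c) })
    (⊠-exchange A B C)
    where
    rank-exchange : ∀ a b c → a + (b + c) ≡ b + (a + c)
    rank-exchange a b c = trans (sym (+-assoc a b c)) (trans (cong (_+ c) (+-comm a b)) (+-assoc b a c))

  decomp-exchangeʳ : ∀ A B C → Decomp (G ⊗ (K ⊗ H)) N (λ P Q → Ψ (map₂ swap P) (map₂ swap Q)) (A ⊠ (C ⊠ B)) →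
                     Decomp (G ⊗ (H ⊗ K)) N Ψ (A ⊠ (B ⊠ C))
  decomp-exchangeʳ A B C = decomp-map (map₂ swap)
    (λ { (left e) → left e ; (right (left e)) → right (right e) ; (right (right e)) → right (left e) })
    (λ { (a , c , b) → cong (G.rank a +_) (+-comm (H.rank b) (K.rank c)) })
    (⊠-exchangeʳ A B C)

decomp-bind : ∀ {G H M N Φ Ψ L} (C : List (Carrier H)) → Decomp G M Φ L →
              (∀ {E} → Sym G M E → Pairs Φ E → (∀ {P} → P ∈ E → P ∈ L) → Decomp (G ⊗ H) N Ψ (E ⊠ C)) →
              Decomp (G ⊗ H) N Ψ (L ⊠ C)
decomp-bind {G} {H} {N = N} {Ψ = Ψ} C (𝓔 , p , a) f
  with gather (_⊠ C) (λ _ D → Sym (G ⊗ H) N D × Pairs Ψ D) 𝓔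
         (λ E∈ → f (proj₁ (All.lookup a E∈)) (proj₂ (All.lookup a E∈)) (chain-⊆ 𝓔 p E∈))
... | 𝓓 , q , b =
  𝓓 , ↭-trans q (↭-trans (↭-reflexive (⊠-concatˡ 𝓔 C)) (⊠-congˡ C p)) , All.map (λ { (_ , _ , s) → s }) b

-- `Jump` and `Tail` stay abstract, so that boxes are cut without reference to cubes. Later a jump
-- is the pair of ∅ and the full set on a chain containing both, and a tail is a vertex whose
-- out-neighbour lies on the chain.
record Line (G : Graded) : Set₁ where
  field
    pts       : List (Carrier G)
    {bot top} : Carrier G
    path      : Path G bot top pts
    Jump      : Carrier G → Carrier G → Set
    Tail      : Carrier G → Set
    prio      : ℕ
  level : ℕ
  level = Graded.rank G bot + Graded.rank G top

open Line public using (pts; bot; top; path; Jump; Tail; prio; level)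

-- The priority decides which of two 2-element chains has to account for a jump.
Thin : ∀ {G H} (β : Line G) (γ : Line H) → Carrier G → Carrier H → Set
Thin β γ b c = length (pts β) ≤ 2 × length (pts γ) ≤ 2 ×
  (length (pts β) ≡ 1 ⊎ length (pts γ) ≡ 1 ⊎ (prio β < prio γ × Tail β b) ⊎ (prio γ < prio β × Tail γ c))

Thin-sym : ∀ {G H} (β : Line G) (γ : Line H) {b c} → Thin β γ b c → Thin γ β c b
Thin-sym β γ (k , l , inj₁ s)               = l , k , inj₂ (inj₁ s)
Thin-sym β γ (k , l , inj₂ (inj₁ s))        = l , k , inj₁ s
Thin-sym β γ (k , l , inj₂ (inj₂ (inj₁ s))) = l , k , inj₂ (inj₂ (inj₂ s))
Thin-sym β γ (k , l , inj₂ (inj₂ (inj₂ s))) = l , k , inj₂ (inj₂ (inj₁ s))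

-- No clause treats three simultaneous jumps: the two points are then ∅ and the full set of the
-- product, which almost orthogonal chains may share. The permitted exceptions speak only of the
-- fixed coordinates and their chains, which is what can be compared between two different
-- decompositions.
record Separated {X Y Z : Graded} (α : Line X) (β : Line Y) (γ : Line Z)
                 (P Q : Carrier (X ⊗ (Y ⊗ Z))) : Set where
  constructor separated
  private
    a = proj₁ P
    b = proj₁ (proj₂ P)
    c = proj₂ (proj₂ P)
    a′ = proj₁ Q
    b′ = proj₁ (proj₂ Q)
    c′ = proj₂ (proj₂ Q)
  field
    jump₁  : Jump α a a′ → b ≡ b′ → c ≡ c′ → Thin β γ b c
    jump₂  : a ≡ a′ → Jump β b b′ → c ≡ c′ → Thin α γ a c
    jump₃  : a ≡ a′ → b ≡ b′ → Jump γ c c′ → Thin α β a b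
    jump₁₂ : Jump α a a′ → Jump β b b′ → c ≡ c′ → length (pts γ) ≡ 1
    jump₁₃ : Jump α a a′ → b ≡ b′ → Jump γ c c′ → length (pts β) ≡ 1
    jump₂₃ : a ≡ a′ → Jump β b b′ → Jump γ c c′ → length (pts α) ≡ 1

Cuboid : ∀ {X Y Z} → Line X → Line Y → Line Z → Set
Cuboid {X} {Y} {Z} α β γ =
  Decomp (X ⊗ (Y ⊗ Z)) (level α + (level β + level γ)) (Separated α β γ) (pts α ⊠ (pts β ⊠ pts γ))

module _ {X Y Z : Graded} (α : Line X) (β : Line Y) (γ : Line Z) where

  cuboid-exchange : Cuboid β α γ → Cuboid α β γ
  cuboid-exchange d = decomp-exchange (pts α) (pts β) (pts γ)
    (subst (λ N → Decomp (Y ⊗ (X ⊗ Z)) N (λ P Q → Separated α β γ (exchange P) (exchange Q)) (pts β ⊠ (pts α ⊠ pts γ)))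
      (trans (sym (+-assoc (level β) (level α) (level γ))) (trans (cong (_+ level γ) (+-comm (level β) (level α))) (+-assoc (level α) (level β) (level γ))))
      (decomp-mono (λ _ _ (separated j₁ j₂ j₃ j₁₂ j₁₃ j₂₃) → separated
        (λ a b c → j₂ b a c) (λ a b c → j₁ b a c) (λ a b c → Thin-sym β α (j₃ b a c))
        (λ a b c → j₁₂ b a c) (λ a b c → j₂₃ b a c) (λ a b c → j₁₃ b a c)) d))

  cuboid-exchangeʳ : Cuboid α γ β → Cuboid α β γ
  cuboid-exchangeʳ d = decomp-exchangeʳ (pts α) (pts β) (pts γ)
    (subst (λ N → Decomp (X ⊗ (Z ⊗ Y)) N (λ P Q → Separated α β γ (map₂ swap P) (map₂ swap Q)) (pts α ⊠ (pts γ ⊠ pts β)))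
      (cong (level α +_) (+-comm (level γ) (level β)))
      (decomp-mono (λ _ _ (separated j₁ j₂ j₃ j₁₂ j₁₃ j₂₃) → separated
        (λ a b c → Thin-sym γ β (j₁ a c b)) (λ a b c → j₃ a c b) (λ a b c → j₂ a c b)
        (λ a b c → j₁₃ a c b) (λ a b c → j₁₂ a c b) (λ a b c → j₂₃ a c b)) d))

-- Cutting a box by way of a cut of two of its factors

EndToEnd : ∀ {G} → Line G → Set
EndToEnd α = ∀ {u v} → Jump α u v → u ≡ bot α × v ≡ top α

Flat : ∀ {G} → Line G → Set
Flat α = ∀ {u v} → ¬ Jump α u v

sum-swap : ∀ a b c d → (a + b) + (c + d) ≡ (a + c) + (b + d)
sum-swap = solve 4 (λ a b c d → (a :+ b) :+ (c :+ d) := (a :+ c) :+ (b :+ d)) refl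
  where open +-*-Solver

balanced-⊗ : (G H : Graded) (x z : Carrier G) (y w : Carrier H) {M L : ℕ} →
             Graded.rank G x + Graded.rank G z ≡ M → Graded.rank H y + Graded.rank H w ≡ L →
             Graded.rank (G ⊗ H) (x , y) + Graded.rank (G ⊗ H) (z , w) ≡ M + L
balanced-⊗ G H x z y w refl refl = sum-swap (Graded.rank G x) (Graded.rank H y) (Graded.rank G z) (Graded.rank H w)

module _ {X Y Z : Graded} (α : Line X) (β : Line Y) (γ : Line Z) where
  private
    T = X ⊗ (Y ⊗ Z)
    S : Carrier ((X ⊗ Y) ⊗ Z) → Carrier ((X ⊗ Y) ⊗ Z) → Set
    S P Q = Separated α β γ (assoc P) (assoc Q)

  cuboid-assoc : Decomp ((X ⊗ Y) ⊗ Z) ((level α + level β) + level γ) S ((pts α ⊠ pts β) ⊠ pts γ) → Cuboid α β γ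
  cuboid-assoc d = subst (λ N → Decomp T N (Separated α β γ) (pts α ⊠ (pts β ⊠ pts γ))) (+-assoc (level α) (level β) (level γ))
    (decomp-assoc (↭-reflexive (⊠-assoc (pts α) (pts β) (pts γ))) d)

  slab : ∀ {E} → Sym (X ⊗ Y) (level α + level β) E → (∀ P Q → proj₁ P ∈ E → proj₁ Q ∈ E → S P Q) →
         Decomp ((X ⊗ Y) ⊗ Z) ((level α + level β) + level γ) S (E ⊠ pts γ)
  slab {E} (symmetric {e₀} {e₁} p b) s = decomp-mono
    (λ P∈ Q∈ _ → s _ _ (proj₁ (∈-cartesianProduct⁻ E (pts γ) P∈)) (proj₁ (∈-cartesianProduct⁻ E (pts γ) Q∈)))
    (hooks p (path γ) (balanced-⊗ (X ⊗ Y) Z e₀ e₁ (bot γ) (top γ) b refl))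

  cuboid-hooks : (∀ P Q → S P Q) → Cuboid α β γ
  cuboid-hooks s = cuboid-assoc (decomp-bind (pts γ)
    (hooks (path α) (path β) (balanced-⊗ X Y (bot α) (top α) (bot β) (top β) refl refl))
    (λ E _ _ → slab E (λ P Q _ _ → s P Q)))

apart : ∀ {G H N x z A y w C} → Detour G H N x z A y w C → Decomp (G ⊗ H) N (Apart x z y w) (A ⊠ C)
apart d = decomp-↭ partition
  (decomp-single (symmetric side-path side-balanced) side-apart
   decomp-++ decomp-single (symmetric spine-path spine-balanced) spine-apart
   decomp-++ decomp-mono
     -- The block lacks `x` and `w`, so no run along the first path can start in it and no run along
     -- the second can end in it; plain hooks are enough there.
     (λ P∈ Q∈ _ → (λ a → ⊥-elim (All.lookup blockˡ-≢ (proj₁ (∈-cartesianProduct⁻ blockˡ blockʳ P∈)) (sym a))) ,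
                  (λ _ c → ⊥-elim (All.lookup blockʳ-≢ (proj₂ (∈-cartesianProduct⁻ blockˡ blockʳ Q∈)) c)))
     (hooks blockˡ-path blockʳ-path block-balanced))
  where open Detour d

module _ {X Y Z : Graded} (α : Line X) (β : Line Y) (γ : Line Z)
         (α-ends : EndToEnd α) (β-ends : EndToEnd β) where
  private
    T = X ⊗ (Y ⊗ Z)
    A = pts α
    B = pts β
    C = pts γ
    N = (level α + level β) + level γ
    S : Carrier ((X ⊗ Y) ⊗ Z) → Carrier ((X ⊗ Y) ⊗ Z) → Set
    S P Q = Separated α β γ (assoc P) (assoc Q)
    Apartᵅᵝ : Carrier (X ⊗ Y) → Carrier (X ⊗ Y) → Set
    Apartᵅᵝ = Apart (bot α) (top α) (bot β) (top β)

    no-jump₁ : ∀ {P Q} → Apartᵅᵝ P Q → Jump α (proj₁ P) (proj₁ Q) → proj₂ P ≢ proj₂ Q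
    no-jump₁ φ j = proj₁ φ (proj₁ (α-ends j)) (proj₂ (α-ends j))

    no-jump₂ : ∀ {P Q} → Apartᵅᵝ P Q → Jump β (proj₂ P) (proj₂ Q) → proj₁ P ≢ proj₁ Q
    no-jump₂ φ j = proj₂ φ (proj₁ (β-ends j)) (proj₂ (β-ends j))

  module _ (lA : 3 ≤ length A) (lB : 3 ≤ length B) where
    private
      d : Detour X Y (level α + level β) (bot α) (top α) A (bot β) (top β) B
      d = detour (path α) (path β) lA lB (balanced-⊗ X Y (bot α) (top α) (bot β) (top β) refl refl)

    -- After a detour in the product of `α` and `β` only their simultaneous jump is left. The second
    -- hypothesis covers two situations: `γ` is a singleton, where this is a permitted exception, or
    -- one of `α`, `β` has no jump.
    cuboid-flat : Flat γ → (∀ {a a′ b b′} → Jump α a a′ → Jump β b b′ → length C ≡ 1) → Cuboid α β γ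
    cuboid-flat γ-flat γ-single = cuboid-assoc α β γ (decomp-bind C (apart d) λ E φ _ →
      slab α β γ E λ P Q P∈ Q∈ → separated
        (λ j b _ → ⊥-elim (no-jump₁ (φ P∈ Q∈) j b))
        (λ a j _ → ⊥-elim (no-jump₂ (φ P∈ Q∈) j a))
        (λ _ _ j → ⊥-elim (γ-flat j))
        (λ i j _ → γ-single i j)
        (λ _ _ j → ⊥-elim (γ-flat j))
        (λ _ _ j → ⊥-elim (γ-flat j)))

    -- `side` and `spine` make a second detour against `γ`. It removes the jumps of `γ`, and on the
    -- spine also the simultaneous jump of `α` and `β`, which is now the run through the whole spine
    -- over a fixed point of `γ`. In the block only `γ` can jump, and a detour in `blockˡ ⊠ C`
    -- prevents it; as `blockˡ` is two shorter than `A`, this needs five points in `A`.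
    cuboid-long : EndToEnd γ → 5 ≤ length A → 3 ≤ length C → Cuboid α β γ
    cuboid-long γ-ends lA′ lC = subst (λ N → Decomp T N (Separated α β γ) (A ⊠ (B ⊠ C))) (+-assoc (level α) (level β) (level γ))
      (decomp-↭ partition′
        (decomp-assoc ↭-refl (thick side-path side-balanced side-long side-apart
           (λ P∈ _ b _ _ _ → ⊥-elim (All.lookup side-no-bottom P∈ b)))
         decomp-++ decomp-assoc ↭-refl (thick spine-path spine-balanced spine-long spine-apart
           (λ { {_ , _} {_ , _} _ _ refl refl refl refl → refl , refl }))
         decomp-++ block))
      where
      open Detour d

      partition′ : map assoc (side ⊠ C) ++ map assoc (spine ⊠ C) ++ blockˡ ⊠ (blockʳ ⊠ C) ↭ A ⊠ (B ⊠ C)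
      partition′ = begin
        map assoc (side ⊠ C) ++ map assoc (spine ⊠ C) ++ blockˡ ⊠ (blockʳ ⊠ C)
          ≡⟨ cong (λ L → map assoc (side ⊠ C) ++ map assoc (spine ⊠ C) ++ L) (sym (⊠-assoc blockˡ blockʳ C)) ⟩
        map assoc (side ⊠ C) ++ map assoc (spine ⊠ C) ++ map assoc ((blockˡ ⊠ blockʳ) ⊠ C)
          ≡⟨ cong (map assoc (side ⊠ C) ++_) (sym (map-++ assoc (spine ⊠ C) _)) ⟩
        map assoc (side ⊠ C) ++ map assoc (spine ⊠ C ++ (blockˡ ⊠ blockʳ) ⊠ C)
          ≡⟨ cong (λ L → map assoc (side ⊠ C) ++ map assoc L) (sym (cartesianProductWith-distribʳ-++ _,_ spine _ C)) ⟩
        map assoc (side ⊠ C) ++ map assoc ((spine ++ blockˡ ⊠ blockʳ) ⊠ C)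
          ≡⟨ sym (map-++ assoc (side ⊠ C) _) ⟩
        map assoc (side ⊠ C ++ (spine ++ blockˡ ⊠ blockʳ) ⊠ C)
          ≡⟨ cong (map assoc) (sym (cartesianProductWith-distribʳ-++ _,_ side _ C)) ⟩
        map assoc ((side ++ spine ++ blockˡ ⊠ blockʳ) ⊠ C)
          ↭⟨ ↭.map⁺ assoc (⊠-congˡ C partition) ⟩
        map assoc ((A ⊠ B) ⊠ C)
          ≡⟨ ⊠-assoc A B C ⟩
        A ⊠ (B ⊠ C) ∎
        where open PermutationReasoning

      thick : ∀ {e₀ e₁ E} → Path (X ⊗ Y) e₀ e₁ E →
              Graded.rank (X ⊗ Y) e₀ + Graded.rank (X ⊗ Y) e₁ ≡ level α + level β →
              3 ≤ length E → Pairs Apartᵅᵝ E →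
              (∀ {P Q} → P ∈ E → Q ∈ E → proj₂ P ≡ bot β → proj₁ P ≡ bot α → proj₁ Q ≡ top α → proj₂ Q ≡ top β →
                 P ≡ e₀ × Q ≡ e₁) →
              Decomp ((X ⊗ Y) ⊗ Z) N S (E ⊠ C)
      thick {e₀} {e₁} {E} p b l φ corner = decomp-mono
        (λ P∈ Q∈ ψ →
          let P∈E = proj₁ (∈-cartesianProduct⁻ E C P∈)
              Q∈E = proj₁ (∈-cartesianProduct⁻ E C Q∈) in
          separated
            (λ j b _ → ⊥-elim (no-jump₁ (φ P∈E Q∈E) j b))
            (λ a j _ → ⊥-elim (no-jump₂ (φ P∈E Q∈E) j a))
            (λ a b j → ⊥-elim (proj₂ ψ (proj₁ (γ-ends j)) (proj₂ (γ-ends j)) (cong₂ _,_ a b)))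
            (λ i j c → ⊥-elim
              (let e = corner P∈E Q∈E (proj₁ (β-ends j)) (proj₁ (α-ends i)) (proj₂ (α-ends i)) (proj₂ (β-ends j)) in
               proj₁ ψ (proj₁ e) (proj₂ e) c))
            (λ i b _ → ⊥-elim (no-jump₁ (φ P∈E Q∈E) i b))
            (λ a j _ → ⊥-elim (no-jump₂ (φ P∈E Q∈E) j a)))
        (apart (detour p (path γ) l lC (balanced-⊗ (X ⊗ Y) Z e₀ e₁ (bot γ) (top γ) b refl)))

      block : Decomp T N (Separated α β γ) (blockˡ ⊠ (blockʳ ⊠ C))
      block = decomp-exchangeʳ blockˡ blockʳ C (decomp-assoc (↭-reflexive (⊠-assoc blockˡ C blockʳ))
        (decomp-bind blockʳ
          (apart (detour blockˡ-path (path γ) (≤-pred (≤-pred (≤-trans lA′ (≤-reflexive (sym blockˡ-length))))) lC refl))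
          (λ {E} (symmetric {u₀} {u₁} p b) φ E⊆ → decomp-mono
            (λ P∈ Q∈ _ →
              let P∈E , P₂∈ = ∈-cartesianProduct⁻ E blockʳ P∈
                  Q∈E , Q₂∈ = ∈-cartesianProduct⁻ E blockʳ Q∈
                  no₁ = λ j → All.lookup blockˡ-≢ (proj₁ (∈-cartesianProduct⁻ blockˡ C (E⊆ P∈E))) (sym (proj₁ (α-ends j)))
                  no₂ = λ j → All.lookup blockʳ-≢ Q₂∈ (proj₂ (β-ends j)) in
              separated
                (λ j _ _ → ⊥-elim (no₁ j))
                (λ _ j _ → ⊥-elim (no₂ j))
                (λ a _ j → ⊥-elim (proj₂ (φ P∈E Q∈E) (proj₁ (γ-ends j)) (proj₂ (γ-ends j)) a))
                (λ j _ _ → ⊥-elim (no₁ j))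
                (λ j _ _ → ⊥-elim (no₁ j))
                (λ _ j _ → ⊥-elim (no₂ j)))
            (hooks p blockʳ-path
              (trans (balanced-⊗ (X ⊗ Z) Y u₀ u₁ (bot β) w₂ b refl)
                (trans (rearrange (rk X x₂) (rk Z (bot γ)) (rk X (top α)) (rk Z (top γ)) (rk Y (bot β)) (rk Y w₂))
                  (cong (_+ level γ) block-balanced)))))))
        where
        rk = Graded.rank
        rearrange : ∀ x c z c′ y w → ((x + c) + (z + c′)) + (y + w) ≡ ((x + y) + (z + w)) + (c + c′)
        rearrange = solve 6 (λ x c z c′ y w → ((x :+ c) :+ (z :+ c′)) :+ (y :+ w) := ((x :+ y) :+ (z :+ w)) :+ (c :+ c′)) refl
          where open +-*-Solver

-- Boxes with a 2-element chain

init-path : ∀ {G x z} {A : List (Carrier G)} → Path G x z A → 2 ≤ length A →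
            ∃₂ λ A′ v → A ≡ A′ ∷ʳ z × Path G x v A′ × Graded._⋖_ G v z × suc (length A′) ≡ length A
init-path [-] (s≤s ())
init-path {G} {x} {z} (_∷_ {c = u ∷ c} e p) _ with snoc-view u c
... | B , w , eq with path-init B (subst (λ D → Path G x z (x ∷ D)) eq (e ∷ p))
                   | path-last (x ∷ B) (subst (λ D → Path G x z (x ∷ D)) eq (e ∷ p))
...   | v , q , f | refl = x ∷ B , v , cong (x ∷_) eq , q , f ,
  cong suc (trans (sym (trans (length-++ B) (+-comm (length B) 1))) (cong length (sym eq)))

module _ {Z X : Set} (g₀ g₁ : Z) {z : X} {A A′ : List X} (A≡ : A ≡ A′ ∷ʳ z) where

  -- Of these two chains only the first can contain both ends of `A` over a common `g`, and then
  -- only over `g₀`.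
  ladder-partition : (col g₀ A ∷ʳ (g₁ , z)) ++ col g₁ A′ ↭ (g₀ ∷ g₁ ∷ []) ⊠ A
  ladder-partition = begin
    (col g₀ A ∷ʳ (g₁ , z)) ++ col g₁ A′
      ≡⟨ cong (λ B → (col g₀ B ∷ʳ (g₁ , z)) ++ col g₁ A′) A≡ ⟩
    (col g₀ (A′ ∷ʳ z) ++ [ (g₁ , z) ]) ++ col g₁ A′
      ≡⟨ cong (λ B → (B ++ [ (g₁ , z) ]) ++ col g₁ A′) (map-++ (g₀ ,_) A′ [ z ]) ⟩
    ((col g₀ A′ ++ [ (g₀ , z) ]) ++ [ (g₁ , z) ]) ++ col g₁ A′
      ↭⟨ ↭-solve 4 (λ a b c d → ((a ⊕ b) ⊕ c) ⊕ d ⊜ a ⊕ (b ⊕ c) ⊕ d) ↭-refl (col g₀ A′) [ (g₀ , z) ] [ (g₁ , z) ] (col g₁ A′) ⟩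
    col g₀ A′ ++ row (g₀ ∷ g₁ ∷ []) z ++ col g₁ A′
      ≡⟨ cong (λ B → col g₀ A′ ++ row (g₀ ∷ g₁ ∷ []) z ++ B) (sym (++-identityʳ (col g₁ A′))) ⟩
    col g₀ A′ ++ row (g₀ ∷ g₁ ∷ []) z ++ [ g₁ ] ⊠ A′
      ↭⟨ ⊠-hook g₀ [ g₁ ] A′ z ⟨
    (g₀ ∷ g₁ ∷ []) ⊠ (A′ ∷ʳ z)
      ≡⟨ cong ((g₀ ∷ g₁ ∷ []) ⊠_) (sym A≡) ⟩
    (g₀ ∷ g₁ ∷ []) ⊠ A ∎
    where open PermutationReasoning

ladder-balanced : (Z X : Graded) {g₀ g₁ : Carrier Z} (x : Carrier X) {v z : Carrier X} →
  Graded._⋖_ Z g₀ g₁ → Graded._⋖_ X v z →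
  Graded.rank (Z ⊗ X) (g₁ , x) + Graded.rank (Z ⊗ X) (g₁ , v) ≡
  (Graded.rank Z g₀ + Graded.rank Z g₁) + (Graded.rank X x + Graded.rank X z)
ladder-balanced Z X {g₀} x {v} g f rewrite Graded.rank-⋖ Z g | Graded.rank-⋖ X f =
  solve 3 (λ g x v → ((con 1 :+ g) :+ x) :+ ((con 1 :+ g) :+ v) := (g :+ (con 1 :+ g)) :+ (x :+ (con 1 :+ v))) refl
    (Graded.rank Z g₀) (Graded.rank X x) (Graded.rank X v)
  where open +-*-Solver

-- A run from `x` to `z` over a fixed pair of the other coordinates is inevitable in a box with two
-- 2-element chains. All such runs can, however, be put over one end `t` of the chain in `Y`, and
-- the two ladders offer either end.
Steady : {X Y Z : Set} (x z : X) (t : Y) (P Q : (Z × X) × Y) → Set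
Steady x z t ((c , a) , b) ((c′ , a′) , b′) = c ≡ c′ → a ≡ x → a′ ≡ z → b ≡ b′ → b ≡ t

module _ {X Y Z : Graded} {N : ℕ} {g₀ g₁ : Carrier Z} (g : Graded._⋖_ Z g₀ g₁) where
  private
    rk : (G : Graded) → Carrier G → ℕ
    rk = Graded.rank

  -- The main chain climbs to `b₁` right after its first point and so passes along `A` at height
  -- `b₁`, over `g₀`. Its remainder at height `b₀` starts beyond `x`, and the grid over `g₁` lacks
  -- `z`.
  ladder-top : ∀ {x z A b₀ b₁} → Path X x z A → Graded._⋖_ Y b₀ b₁ → 2 ≤ length A →
               ((rk Z g₀ + rk Z g₁) + (rk X x + rk X z)) + (rk Y b₀ + rk Y b₁) ≡ N →
               Decomp ((Z ⊗ X) ⊗ Y) N (Steady x z b₁) (((g₀ ∷ g₁ ∷ []) ⊠ A) ⊠ (b₀ ∷ b₁ ∷ []))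
  ladder-top {b₀ = b₀} {b₁} [-] h (s≤s ()) s
  ladder-top {x} {z} {b₀ = b₀} {b₁} (_∷_ {y = x₁} {c = A″} e p) h lA s with init-path (e ∷ p) lA
  ... | A′ , v , A≡ , p′ , f , _ = decomp-↭ partition
    (decomp-single
       (symmetric (right h ∷ row-path b₁ (left′ (e ∷ p)))
         (trans (balanced-⊗ (Z ⊗ X) Y (g₀ , x) (g₁ , z) b₀ b₁ (balanced-⊗ Z X g₀ g₁ x z refl refl) refl) s))
       (λ P∈ Q∈ _ _ a′ b → trans b (All.lookup up Q∈ a′))
     decomp-++
     decomp-single
       (symmetric (row-path b₀ (left′ p)) (trans balanced s))
       (λ P∈ _ _ a → ⊥-elim (All.lookup below P∈ a))
     decomp-++
     decomp-mono (λ _ Q∈ _ _ _ a′ → ⊥-elim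
         (All.lookup side≢z (proj₁ (∈-cartesianProduct⁻ (col g₁ A′) (b₀ ∷ b₁ ∷ []) Q∈)) a′))
       (hooks (col-path g₁ p′) (h ∷ [-])
         (trans (balanced-⊗ (Z ⊗ X) Y (g₁ , x) (g₁ , v) b₀ b₁ (ladder-balanced Z X x g f) refl) s)))
    where
    e₀ = (g₀ , x)
    R = col g₀ A″ ∷ʳ (g₁ , z)
    left′ : ∀ {u C} → Path X u z C → Path (Z ⊗ X) (g₀ , u) (g₁ , z) (col g₀ C ∷ʳ (g₁ , z))
    left′ q = col-path g₀ q ⟨ left g ⟩ [-]
    x≢ : All (x ≢_) A″
    x≢ = head≢tail (e ∷ p)
    x≢z : x ≢ z
    x≢z = All.lookup x≢ (last-∈ p)
    A′≢z : All (_≢ z) A′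
    A′≢z = init≢last A′ (subst (Path X x z) A≡ (e ∷ p))
    side≢z : All (λ P → proj₂ P ≢ z) (col g₁ A′)
    side≢z = All.map⁺ A′≢z
    up : All (λ P → proj₂ (proj₁ P) ≡ z → proj₂ P ≡ b₁) ((e₀ , b₀) ∷ row (e₀ ∷ R) b₁)
    up = (λ a → ⊥-elim (x≢z a)) ∷ All.map⁺ (All.universal (λ _ _ → refl) (e₀ ∷ R))
    below : All (λ P → proj₂ (proj₁ P) ≢ x) (row R b₀)
    below = All.map⁺ (All.++⁺ (All.map⁺ (All.map (_∘ sym) x≢)) ((x≢z ∘ sym) ∷ []))
    balanced : rk ((Z ⊗ X) ⊗ Y) ((g₀ , x₁) , b₀) + rk ((Z ⊗ X) ⊗ Y) ((g₁ , z) , b₀) ≡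
               ((rk Z g₀ + rk Z g₁) + (rk X x + rk X z)) + (rk Y b₀ + rk Y b₁)
    balanced rewrite Graded.rank-⋖ X e | Graded.rank-⋖ Y h =
      solve 5 (λ g g′ x z b → ((g :+ (con 1 :+ x)) :+ b) :+ ((g′ :+ z) :+ b) := ((g :+ g′) :+ (x :+ z)) :+ (b :+ (con 1 :+ b))) refl
        (rk Z g₀) (rk Z g₁) (rk X x) (rk X z) (rk Y b₀)
      where open +-*-Solver
    partition : ((e₀ , b₀) ∷ row (e₀ ∷ R) b₁) ++ row R b₀ ++ col g₁ A′ ⊠ (b₀ ∷ b₁ ∷ []) ↭
                ((g₀ ∷ g₁ ∷ []) ⊠ (x ∷ A″)) ⊠ (b₀ ∷ b₁ ∷ [])
    partition = begin
      [ (e₀ , b₀) ] ++ row (e₀ ∷ R) b₁ ++ row R b₀ ++ L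
        ↭⟨ ↭-solve 4 (λ a b c d → a ⊕ b ⊕ c ⊕ d ⊜ (a ⊕ b ⊕ c) ⊕ d) ↭-refl [ (e₀ , b₀) ] (row (e₀ ∷ R) b₁) (row R b₀) L ⟩
      ([ (e₀ , b₀) ] ++ row (e₀ ∷ R) b₁ ++ row R b₀) ++ L
        ≡⟨ cong (λ M → ([ (e₀ , b₀) ] ++ row (e₀ ∷ R) b₁ ++ M) ++ L) (sym (⊠-[] R b₀)) ⟩
      ([ (e₀ , b₀) ] ++ row (e₀ ∷ R) b₁ ++ R ⊠ [ b₀ ]) ++ L
        ↭⟨ ++⁺ʳ L (⊠-hook e₀ R [ b₀ ] b₁) ⟨
      (e₀ ∷ R) ⊠ (b₀ ∷ b₁ ∷ []) ++ L
        ≡⟨ sym (cartesianProductWith-distribʳ-++ _,_ (e₀ ∷ R) (col g₁ A′) (b₀ ∷ b₁ ∷ [])) ⟩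
      ((e₀ ∷ R) ++ col g₁ A′) ⊠ (b₀ ∷ b₁ ∷ [])
        ↭⟨ ⊠-congˡ (b₀ ∷ b₁ ∷ []) (ladder-partition g₀ g₁ A≡) ⟩
      ((g₀ ∷ g₁ ∷ []) ⊠ (x ∷ A″)) ⊠ (b₀ ∷ b₁ ∷ []) ∎
      where
      open PermutationReasoning
      L = col g₁ A′ ⊠ (b₀ ∷ b₁ ∷ [])

  -- The same picture upside down: the main chain passes to `g₁` at once, follows `A` at height `b₀`
  -- and climbs only at its end. The chain at height `b₁` stops before `z`, and the grid over `g₀`
  -- lacks `x`.
  ladder-bottom : ∀ {x z A b₀ b₁} → Path X x z A → Graded._⋖_ Y b₀ b₁ → 2 ≤ length A →
               ((rk Z g₀ + rk Z g₁) + (rk X x + rk X z)) + (rk Y b₀ + rk Y b₁) ≡ N →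
               Decomp ((Z ⊗ X) ⊗ Y) N (Steady x z b₀) (((g₀ ∷ g₁ ∷ []) ⊠ A) ⊠ (b₀ ∷ b₁ ∷ []))
  ladder-bottom {b₀ = b₀} {b₁} [-] h (s≤s ()) s
  ladder-bottom {x} {z} {b₀ = b₀} {b₁} (_∷_ {y = x₁} {c = A″} e p) h lA s with init-path (e ∷ p) lA
  ... | A′ , v , A≡ , p′ , f , _ = decomp-↭ partition
    (decomp-single
       (symmetric (row-path b₀ (left g ∷ col-path g₁ (e ∷ p)) ⟨ right h ⟩ [-])
         (trans (balanced-⊗ (Z ⊗ X) Y (g₀ , x) (g₁ , z) b₀ b₁ (balanced-⊗ Z X g₀ g₁ x z refl refl) refl) s))
       (λ P∈ Q∈ _ a _ _ → All.lookup down P∈ a)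
     decomp-++
     decomp-single
       (symmetric (row-path b₁ (left g ∷ col-path g₁ p′)) (trans balanced s))
       (λ _ Q∈ _ _ a′ → ⊥-elim (All.lookup above Q∈ a′))
     decomp-++
     decomp-mono (λ P∈ _ _ _ a → ⊥-elim
         (All.lookup side≢x (proj₁ (∈-cartesianProduct⁻ (col g₀ A″) (b₀ ∷ b₁ ∷ []) P∈)) a))
       (hooks (col-path g₀ p) (h ∷ [-])
         (trans (balanced-⊗ (Z ⊗ X) Y (g₀ , x₁) (g₀ , z) b₀ b₁ balanced′ refl) s)))
    where
    R = (g₀ , x) ∷ col g₁ A′
    e₁ = (g₁ , z)
    x≢ : All (x ≢_) A″
    x≢ = head≢tail (e ∷ p)
    x≢z : x ≢ z
    x≢z = All.lookup x≢ (last-∈ p)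
    A′≢z : All (_≢ z) A′
    A′≢z = init≢last A′ (subst (Path X x z) A≡ (e ∷ p))
    E = (g₀ , x) ∷ col g₁ (x ∷ A″)
    side≢x : All (λ P → proj₂ P ≢ x) (col g₀ A″)
    side≢x = All.map⁺ (All.map (_∘ sym) x≢)
    down : All (λ P → proj₂ (proj₁ P) ≡ x → proj₂ P ≡ b₀) (row E b₀ ∷ʳ (e₁ , b₁))
    down = All.++⁺ (All.map⁺ (All.universal (λ _ _ → refl) E)) ((λ a → ⊥-elim (x≢z (sym a))) ∷ [])
    above : All (λ P → proj₂ (proj₁ P) ≢ z) (row R b₁)
    above = All.map⁺ (x≢z ∷ All.map⁺ A′≢z)
    balanced : rk ((Z ⊗ X) ⊗ Y) ((g₀ , x) , b₁) + rk ((Z ⊗ X) ⊗ Y) ((g₁ , v) , b₁) ≡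
               ((rk Z g₀ + rk Z g₁) + (rk X x + rk X z)) + (rk Y b₀ + rk Y b₁)
    balanced rewrite Graded.rank-⋖ X f | Graded.rank-⋖ Y h =
      solve 5 (λ g g′ x v b → ((g :+ x) :+ (con 1 :+ b)) :+ ((g′ :+ v) :+ (con 1 :+ b)) := ((g :+ g′) :+ (x :+ (con 1 :+ v))) :+ (b :+ (con 1 :+ b))) refl
        (rk Z g₀) (rk Z g₁) (rk X x) (rk X v) (rk Y b₀)
      where open +-*-Solver
    balanced′ : rk (Z ⊗ X) (g₀ , x₁) + rk (Z ⊗ X) (g₀ , z) ≡ (rk Z g₀ + rk Z g₁) + (rk X x + rk X z)
    balanced′ rewrite Graded.rank-⋖ X e | Graded.rank-⋖ Z g =
      solve 3 (λ g x z → (g :+ (con 1 :+ x)) :+ (g :+ z) := (g :+ (con 1 :+ g)) :+ (x :+ z)) refl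
        (rk Z g₀) (rk X x) (rk X z)
      where open +-*-Solver
    partition : (row E b₀ ∷ʳ (e₁ , b₁)) ++ row R b₁ ++ col g₀ A″ ⊠ (b₀ ∷ b₁ ∷ []) ↭
                ((g₀ ∷ g₁ ∷ []) ⊠ (x ∷ A″)) ⊠ (b₀ ∷ b₁ ∷ [])
    partition = begin
      (row E b₀ ∷ʳ (e₁ , b₁)) ++ row R b₁ ++ L
        ↭⟨ ↭-solve 4 (λ a b c d → (a ⊕ b) ⊕ c ⊕ d ⊜ (a ⊕ (c ⊕ b)) ⊕ d) ↭-refl (row E b₀) [ (e₁ , b₁) ] (row R b₁) L ⟩
      (row E b₀ ++ (row R b₁ ∷ʳ (e₁ , b₁))) ++ L
        ≡⟨ cong (λ M → (row E b₀ ++ M) ++ L) (sym (map-++ (_, b₁) R [ e₁ ])) ⟩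
      (row E b₀ ++ row (R ∷ʳ e₁) b₁) ++ L
        ≡⟨ cong (λ M → (row E b₀ ++ row ((g₀ , x) ∷ M) b₁) ++ L) (trans (sym (map-++ (g₁ ,_) A′ [ z ])) (cong (col g₁) (sym A≡))) ⟩
      (row E b₀ ++ row E b₁) ++ L
        ≡⟨ cong (_++ L) (cong₂ _++_ (sym (⊠-[] E b₀)) (sym (⊠-[] E b₁))) ⟩
      (E ⊠ [ b₀ ] ++ E ⊠ [ b₁ ]) ++ L
        ↭⟨ ++⁺ʳ L (⊠-distribˡ-++ E [ b₀ ] [ b₁ ]) ⟨
      E ⊠ (b₀ ∷ b₁ ∷ []) ++ L
        ≡⟨ sym (cartesianProductWith-distribʳ-++ _,_ E (col g₀ A″) (b₀ ∷ b₁ ∷ [])) ⟩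
      (E ++ col g₀ A″) ⊠ (b₀ ∷ b₁ ∷ [])
        ↭⟨ ⊠-congˡ (b₀ ∷ b₁ ∷ []) (↭-solve 3 (λ a b c → (a ⊕ b) ⊕ c ⊜ (a ⊕ c) ⊕ (b ⊕ cid)) ↭-refl [ (g₀ , x) ] (col g₁ (x ∷ A″)) (col g₀ A″)) ⟩
      ((g₀ ∷ g₁ ∷ []) ⊠ (x ∷ A″)) ⊠ (b₀ ∷ b₁ ∷ []) ∎
      where
      open PermutationReasoning
      open CMSolver (++-commutativeMonoid {A = Carrier (Z ⊗ X)}) using () renaming (id to cid)
      L = col g₀ A″ ⊠ (b₀ ∷ b₁ ∷ [])

-- Only a chain from ∅ to the full set has a jump, and in dimension at least 4 it has at least five
-- members. For every other chain just its length matters and, at length two, the orientation.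
data Shape {G : Graded} (α : Line G) : Set where
  single : Flat α → length (pts α) ≡ 1 → Shape α
  couple : Flat α → pts α ≡ bot α ∷ top α ∷ [] → (prio α < 2 → Tail α (bot α) ⊎ Tail α (top α)) → Shape α
  long   : Flat α → 3 ≤ length (pts α) → Shape α
  full   : EndToEnd α → 5 ≤ length (pts α) → Shape α

couple-edge : ∀ {G x z} {C : List (Carrier G)} → Path G x z C → C ≡ x ∷ z ∷ [] → Graded._⋖_ G x z
couple-edge [-]              ()
couple-edge (e ∷ [-])        _  = e
couple-edge (e ∷ (f ∷ [-]))  ()
couple-edge (e ∷ (f ∷ (_ ∷ _))) ()

module _ {X Y Z : Graded} (γ : Line Z) (α : Line X) (β : Line Y)
         (γ-flat : Flat γ) (γ≡ : pts γ ≡ bot γ ∷ top γ ∷ []) (α-ends : EndToEnd α) where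
  private
    g₀⋖g₁ : Graded._⋖_ Z (bot γ) (top γ)
    g₀⋖g₁ = couple-edge (path γ) γ≡

  -- With γ = {g₀ ⋖ g₁} and B = B′ ∷ʳ b₁ the grid pts γ ⊠ B is cut into g₀ ⊠ B followed by (g₁ , b₁), and g₁ ⊠ B′.
  cuboid-couple-full : EndToEnd β → 5 ≤ length (pts α) → 5 ≤ length (pts β) → Cuboid γ β α
  cuboid-couple-full β-ends lA lB with init-path (path β) (≤-trans (s≤s (s≤s z≤n)) lB)
  ... | B′ , v , B≡ , p′ , f , lB′ = cuboid-assoc γ β α
    (decomp-↭ (↭-trans (↭-reflexive (sym (cartesianProductWith-distribʳ-++ _,_ (F₀ ∷ʳ (top γ , top β)) F₁ (pts α))))
                (⊠-congˡ (pts α) (subst (λ C → (F₀ ∷ʳ (top γ , top β)) ++ F₁ ↭ C ⊠ pts β) (sym γ≡)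
                  (ladder-partition (bot γ) (top γ) B≡))))
      (decomp-mono
         (λ P∈ Q∈ φ →
           -- A jump of `β` on this path starts over `bot γ`, since `bot β` occurs there over
           -- `bot γ` only. With the `γ`-coordinate fixed it ends at `(bot γ , top β)`, the last but
           -- one point of the path; this is the `z` of `braid`, whereas the end of the path is its
           -- `z₀`.
           let start = λ j → All.lookup F₀-bot (proj₁ (∈-cartesianProduct⁻ (F₀ ∷ʳ (top γ , top β)) (pts α) P∈)) (proj₁ (β-ends j))
               P≡ = λ j → cong₂ _,_ (start j) (proj₁ (β-ends j))
               Q≡ = λ c j → cong₂ _,_ (trans (sym c) (start j)) (proj₂ (β-ends j)) in
           separated
             (λ j _ _ → ⊥-elim (γ-flat j))
             (λ c j a → ⊥-elim (proj₁ (proj₁ φ) (P≡ j) (Q≡ c j) a))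
             (λ c b j → ⊥-elim (proj₂ (proj₁ φ) (proj₁ (α-ends j)) (proj₂ (α-ends j)) (cong₂ _,_ c b)))
             (λ j _ _ → ⊥-elim (γ-flat j))
             (λ j _ _ → ⊥-elim (γ-flat j))
             (λ c i j → ⊥-elim (proj₂ φ (P≡ i) (Q≡ c i) (proj₁ (α-ends j)) (proj₂ (α-ends j)))))
         (braid (col-path (bot γ) (path β)) (left g₀⋖g₁) (path α)
           (≤-trans (≤-trans (n≤1+n 4) lB) (≤-reflexive (sym (length-map (bot γ ,_) (pts β))))) lA
           (balanced-⊗ (Z ⊗ Y) X (bot γ , bot β) (top γ , top β) (bot α) (top α)
             (balanced-⊗ Z Y (bot γ) (top γ) (bot β) (top β) refl refl) refl))
       decomp-++ decomp-mono
         (λ P∈ Q∈ φ →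
           let b≢ = All.lookup F₁-top (proj₁ (∈-cartesianProduct⁻ F₁ (pts α) Q∈)) in
           separated
             (λ j _ _ → ⊥-elim (γ-flat j))
             (λ _ j _ → ⊥-elim (b≢ (proj₂ (β-ends j))))
             (λ c b j → ⊥-elim (proj₂ φ (proj₁ (α-ends j)) (proj₂ (α-ends j)) (cong₂ _,_ c b)))
             (λ j _ _ → ⊥-elim (γ-flat j))
             (λ j _ _ → ⊥-elim (γ-flat j))
             (λ _ j _ → ⊥-elim (b≢ (proj₂ (β-ends j)))))
         (apart (detour (col-path (top γ) p′) (path α)
           (≤-trans (≤-trans (n≤1+n 3) (≤-pred (≤-trans lB (≤-reflexive (sym lB′))))) (≤-reflexive (sym (length-map (top γ ,_) B′))))
           (≤-trans (s≤s (s≤s (s≤s z≤n))) lA)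
           (balanced-⊗ (Z ⊗ Y) X (top γ , bot β) (top γ , v) (bot α) (top α)
             (ladder-balanced Z Y (bot β) g₀⋖g₁ f) refl)))))
    where
    F₀ = col (bot γ) (pts β)
    F₁ = col (top γ) B′
    B′≢ : All (_≢ top β) B′
    B′≢ = init≢last B′ (subst (Path Y (bot β) (top β)) B≡ (path β))
    F₀-bot : All (λ P → proj₂ P ≡ bot β → proj₁ P ≡ bot γ) (F₀ ∷ʳ (top γ , top β))
    F₀-bot = All.++⁺ (All.map⁺ (All.universal (λ _ _ → refl) (pts β)))
      ((λ b → ⊥-elim (All.lookup B′≢ (head-∈ p′) (sym b))) ∷ [])
    F₁-top : All (λ P → proj₂ P ≢ top β) F₁
    F₁-top = All.map⁺ B′≢

  -- The end of `β` that is a tail selects the ladder, so that every run along `α` lies over it, as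
  -- `Thin` requires of the chain with the smaller priority.
  cuboid-couple-couple : Flat β → pts β ≡ bot β ∷ top β ∷ [] → prio β < prio γ → Tail β (bot β) ⊎ Tail β (top β) →
                         5 ≤ length (pts α) → Cuboid γ α β
  cuboid-couple-couple β-flat β≡ β<γ t lA = cuboid-assoc γ α β
    (subst (λ C → Decomp ((Z ⊗ X) ⊗ Y) ((level γ + level α) + level β) S ((C ⊠ pts α) ⊠ pts β)) (sym γ≡)
      (subst (λ C → Decomp ((Z ⊗ X) ⊗ Y) ((level γ + level α) + level β) S (((bot γ ∷ top γ ∷ []) ⊠ pts α) ⊠ C)) (sym β≡)
        (ladder t)))
    where
    S : Carrier ((Z ⊗ X) ⊗ Y) → Carrier ((Z ⊗ X) ⊗ Y) → Set
    S P Q = Separated γ α β (assoc P) (assoc Q)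
    l : 2 ≤ length (pts α)
    l = ≤-trans (s≤s (s≤s z≤n)) lA
    edge : Graded._⋖_ Y (bot β) (top β)
    edge = couple-edge (path β) β≡
    two : ∀ {G} (δ : Line G) → pts δ ≡ bot δ ∷ top δ ∷ [] → length (pts δ) ≤ 2
    two δ δ≡ = ≤-reflexive (cong length δ≡)
    steady : ∀ {t} → Tail β t → ∀ {P Q} → Steady (bot α) (top α) t P Q → S P Q
    steady τ φ = separated
      (λ j _ _ → ⊥-elim (γ-flat j))
      (λ c j b → two γ γ≡ , two β β≡ , inj₂ (inj₂ (inj₂
        (β<γ , subst (Tail β) (sym (φ c (proj₁ (α-ends j)) (proj₂ (α-ends j)) b)) τ))))
      (λ _ _ j → ⊥-elim (β-flat j))
      (λ j _ _ → ⊥-elim (γ-flat j))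
      (λ j _ _ → ⊥-elim (γ-flat j))
      (λ _ _ j → ⊥-elim (β-flat j))
    ladder : Tail β (bot β) ⊎ Tail β (top β) →
             Decomp ((Z ⊗ X) ⊗ Y) ((level γ + level α) + level β) S (((bot γ ∷ top γ ∷ []) ⊠ pts α) ⊠ (bot β ∷ top β ∷ []))
    ladder (inj₁ τ) = decomp-mono (λ _ _ → steady τ) (ladder-bottom g₀⋖g₁ (path α) edge l refl)
    ladder (inj₂ τ) = decomp-mono (λ _ _ → steady τ) (ladder-top g₀⋖g₁ (path α) edge l refl)

-- Choice of the cut by the shapes of the three chains

module _ {X Y Z : Graded} (α : Line X) (β : Line Y) (γ : Line Z) where

  all-flat : Flat α → Flat β → Flat γ → Cuboid α β γ
  all-flat fα fβ fγ = cuboid-hooks α β γ λ _ _ → separated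
    (λ j _ _ → ⊥-elim (fα j)) (λ _ j _ → ⊥-elim (fβ j)) (λ _ _ j → ⊥-elim (fγ j))
    (λ j _ _ → ⊥-elim (fα j)) (λ j _ _ → ⊥-elim (fα j)) (λ _ j _ → ⊥-elim (fβ j))

  -- With a singleton present, `Thin` holds at every point of the box, so ordinary hooks may run
  -- along `α` anywhere.
  thin-flat : Flat β → Flat γ → length (pts β) ≤ 2 → length (pts γ) ≤ 2 →
              length (pts β) ≡ 1 ⊎ length (pts γ) ≡ 1 → Cuboid α β γ
  thin-flat fβ fγ l m s = cuboid-hooks α β γ λ _ _ → separated
    (λ _ _ _ → l , m , weaken s) (λ _ j _ → ⊥-elim (fβ j)) (λ _ _ j → ⊥-elim (fγ j))
    (λ _ j _ → ⊥-elim (fβ j)) (λ _ _ j → ⊥-elim (fγ j)) (λ _ j _ → ⊥-elim (fβ j))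
    where
    weaken : ∀ {A B C : Set} → A ⊎ B → A ⊎ B ⊎ C
    weaken (inj₁ a) = inj₁ a
    weaken (inj₂ b) = inj₂ (inj₁ b)

  two-full : EndToEnd α → 5 ≤ length (pts α) → EndToEnd β → 5 ≤ length (pts β) → Shape γ → Cuboid α β γ
  two-full eα lα eβ lβ (single fγ l) =
    cuboid-flat α β γ eα eβ (≤-trans (m≤n+m 3 2) lα) (≤-trans (m≤n+m 3 2) lβ) fγ (λ _ _ → l)
  two-full eα lα eβ lβ (couple fγ γ≡ _) =
    cuboid-exchange α β γ (cuboid-exchangeʳ β α γ (cuboid-exchange β γ α
      (cuboid-couple-full γ α β fγ γ≡ eα eβ lα lβ)))
  two-full eα lα eβ lβ (long fγ l) =
    cuboid-long α β γ eα eβ (≤-trans (m≤n+m 3 2) lα) (≤-trans (m≤n+m 3 2) lβ) (λ j → ⊥-elim (fγ j)) lα l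
  two-full eα lα eβ lβ (full eγ l) =
    cuboid-long α β γ eα eβ (≤-trans (m≤n+m 3 2) lα) (≤-trans (m≤n+m 3 2) lβ) eγ lα (≤-trans (m≤n+m 3 2) l)

  full-long : EndToEnd α → 5 ≤ length (pts α) → Flat β → 3 ≤ length (pts β) → Flat γ → Cuboid α β γ
  full-long eα lα fβ lβ fγ =
    cuboid-flat α β γ eα (λ j → ⊥-elim (fβ j)) (≤-trans (m≤n+m 3 2) lα) lβ fγ (λ _ j → ⊥-elim (fβ j))

two-couples : ∀ {X Y Z} (α : Line X) (β : Line Y) (γ : Line Z) → EndToEnd α → 5 ≤ length (pts α) →
              Flat β → pts β ≡ bot β ∷ top β ∷ [] → Flat γ → pts γ ≡ bot γ ∷ top γ ∷ [] →
              prio β < prio γ → Tail β (bot β) ⊎ Tail β (top β) → Cuboid α β γ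
two-couples α β γ eα lα fβ β≡ fγ γ≡ β<γ t =
  cuboid-exchangeʳ α β γ (cuboid-exchange α γ β (cuboid-couple-couple γ α β fγ γ≡ eα fβ β≡ β<γ t lα))

one-full : ∀ {X Y Z} (α : Line X) (β : Line Y) (γ : Line Z) → prio β ≢ prio γ → prio β ≤ 2 → prio γ ≤ 2 →
           EndToEnd α → 5 ≤ length (pts α) → Shape β → Shape γ → Cuboid α β γ
one-full α β γ _ _ _ eα lα (full eβ lβ) sγ = two-full α β γ eα lα eβ lβ sγ
one-full α β γ _ _ _ eα lα sβ (full eγ lγ) = cuboid-exchangeʳ α β γ (two-full α γ β eα lα eγ lγ sβ)
one-full α β γ _ _ _ eα lα (long fβ l) (single fγ _)   = full-long α β γ eα lα fβ l fγ
one-full α β γ _ _ _ eα lα (long fβ l) (couple fγ _ _) = full-long α β γ eα lα fβ l fγ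
one-full α β γ _ _ _ eα lα (long fβ l) (long fγ _)     = full-long α β γ eα lα fβ l fγ
one-full α β γ _ _ _ eα lα (single fβ _) (long fγ l)   = cuboid-exchangeʳ α β γ (full-long α γ β eα lα fγ l fβ)
one-full α β γ _ _ _ eα lα (couple fβ _ _) (long fγ l) = cuboid-exchangeʳ α β γ (full-long α γ β eα lα fγ l fβ)
one-full α β γ _ _ _ eα lα (single fβ l) (single fγ m) =
  thin-flat α β γ fβ fγ (≤-trans (≤-reflexive l) (n≤1+n 1)) (≤-trans (≤-reflexive m) (n≤1+n 1)) (inj₁ l)
one-full α β γ _ _ _ eα lα (single fβ l) (couple fγ γ≡ _) =
  thin-flat α β γ fβ fγ (≤-trans (≤-reflexive l) (n≤1+n 1)) (≤-reflexive (cong length γ≡)) (inj₁ l)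
one-full α β γ _ _ _ eα lα (couple fβ β≡ _) (single fγ m) =
  thin-flat α β γ fβ fγ (≤-reflexive (cong length β≡)) (≤-trans (≤-reflexive m) (n≤1+n 1)) (inj₂ m)
one-full α β γ β≢γ β≤2 γ≤2 eα lα (couple fβ β≡ tβ) (couple fγ γ≡ tγ) with <-cmp (prio β) (prio γ)
... | tri< β<γ _ _ = two-couples α β γ eα lα fβ β≡ fγ γ≡ β<γ (tβ (≤-trans β<γ γ≤2))
... | tri≈ _ β≡γ _ = ⊥-elim (β≢γ β≡γ)
... | tri> _ _ γ<β = cuboid-exchangeʳ α β γ (two-couples α γ β eα lα fγ γ≡ fβ β≡ γ<β (tγ (≤-trans γ<β β≤2)))

cuboid : ∀ {X Y Z} (α : Line X) (β : Line Y) (γ : Line Z) →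
         prio α ≢ prio β → prio α ≢ prio γ → prio β ≢ prio γ → prio α ≤ 2 → prio β ≤ 2 → prio γ ≤ 2 →
         Shape α → Shape β → Shape γ → Cuboid α β γ
cuboid α β γ αβ αγ βγ pα pβ pγ sα sβ sγ with fullness sα | fullness sβ | fullness sγ
  where
  fullness : ∀ {G} {δ : Line G} → Shape δ → Flat δ ⊎ (EndToEnd δ × 5 ≤ length (pts δ))
  fullness (single f _)   = inj₁ f
  fullness (couple f _ _) = inj₁ f
  fullness (long f _)     = inj₁ f
  fullness (full e l)     = inj₂ (e , l)
... | inj₂ (e , l) | _            | _            = one-full α β γ βγ pβ pγ e l sβ sγ
... | inj₁ _       | inj₂ (e , l) | _            = cuboid-exchange α β γ (one-full β α γ αγ pα pγ e l sα sγ)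
... | inj₁ _       | inj₁ _       | inj₂ (e , l) =
  cuboid-exchangeʳ α β γ (cuboid-exchange α γ β (one-full γ α β αβ pα pβ e l sα sβ))
... | inj₁ fα      | inj₁ fβ      | inj₁ fγ      = all-flat α β γ fα fβ fγ

-- The hypercube

Cube : ℕ → Graded
Cube n = record
  { Carrier = Subset n
  ; _⋖_     = λ s t → s ⊆ t × ∣ t ∣ ≡ suc ∣ s ∣
  ; rank    = ∣_∣
  ; rank-⋖  = proj₂
  }

-- The chain is taken nonempty because for odd `n` the empty list satisfies `IsSymChain` as well,
-- with 2j = n + 1.
symChain⇒Sym : ∀ {n s c} → IsSymChain n (s ∷ c) → Sym (Cube n) n (s ∷ c)
symChain⇒Sym {n} {s} {c} (l , j , len , sizes) with linked⇒path l j sizes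
  where
  linked⇒path : ∀ {s c} → Linked _⊆_ (s ∷ c) → ∀ j → (∀ i → ∣ lookup (s ∷ c) i ∣ ≡ j + toℕ i) →
                ∃ λ t → Path (Cube n) s t (s ∷ c) × ∣ s ∣ ≡ j
  linked⇒path [-]       j sizes = _ , [-] , trans (sizes zero) (+-identityʳ j)
  linked⇒path (s⊆u ∷ l) j sizes with linked⇒path l (suc j) (λ i → trans (sizes (suc i)) (+-suc j (toℕ i)))
  ... | t , p , e = t , (s⊆u , trans e (cong suc (sym e′))) ∷ p , e′
    where e′ = trans (sizes zero) (+-identityʳ j)
... | t , p , e = symmetric p (suc-injective (begin
  suc (∣ s ∣ + ∣ t ∣)                      ≡⟨ sym (+-suc ∣ s ∣ ∣ t ∣) ⟩
  ∣ s ∣ + suc ∣ t ∣                        ≡⟨ cong (∣ s ∣ +_) (sym (path-length p)) ⟩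
  ∣ s ∣ + (length (s ∷ c) + ∣ s ∣)         ≡⟨ cong (λ r → r + (length (s ∷ c) + r)) e ⟩
  j + (length (s ∷ c) + j)                 ≡⟨ solve 2 (λ j l → j :+ (l :+ j) := l :+ (j :+ (j :+ con 0))) refl j (length (s ∷ c)) ⟩
  length (s ∷ c) + 2 * j                   ≡⟨ len ⟩
  suc n ∎))
  where
  open ≡-Reasoning
  open +-*-Solver

Sym⇒symChain : ∀ {n c} → Sym (Cube n) n c → IsSymChain n c
Sym⇒symChain {n} {c₀} (symmetric {s} {t} p b) = linked p , ∣ s ∣ , length≡ , sizes p
  where
  linked : ∀ {s t c} → Path (Cube n) s t c → Linked _⊆_ c
  linked [-]             = [-]
  linked (e ∷ [-])       = proj₁ e ∷ [-]
  linked (e ∷ p@(_ ∷ _)) = proj₁ e ∷ linked p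
  sizes : ∀ {s t c} → Path (Cube n) s t c → ∀ i → ∣ lookup c i ∣ ≡ ∣ s ∣ + toℕ i
  sizes [-]     zero    = sym (+-identityʳ _)
  sizes (e ∷ p) zero    = sym (+-identityʳ _)
  sizes (e ∷ p) (suc i) = trans (sizes p i) (trans (cong (_+ toℕ i) (proj₂ e)) (sym (+-suc _ (toℕ i))))
  length≡ : length c₀ + 2 * ∣ s ∣ ≡ suc n
  length≡ = trans (solve 2 (λ l s → l :+ (s :+ (s :+ con 0)) := (l :+ s) :+ s) refl (length c₀) ∣ s ∣)
    (trans (cong (_+ ∣ s ∣) (path-length p)) (cong suc (trans (+-comm ∣ t ∣ ∣ s ∣) b)))
    where open +-*-Solver

path-unique : ∀ {G x z c} → Path G x z c → Unique c
path-unique [-]         = [] ∷ []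
path-unique p@(_ ∷ p′) = head≢tail p ∷ path-unique p′

AtMostOnce : ∀ {n} → SCD n → Set
AtMostOnce {n} F = ∀ (s : Subset n) (i i′ : Fin (length F)) → s ∈ lookup F i → s ∈ lookup F i′ → i ≡ i′

-- A repetition-free concatenation is the form of disjointness that products, injective maps and
-- permutations preserve; `unique⇒atMostOnce` translates back at the end.
SCD⇒unique : ∀ {n} (F : SCD n) → All (IsSymChain n) F → AtMostOnce F → Unique (concat F)
SCD⇒unique F chains once = Unique.concat⁺ (All.map unique chains) (disjoint F once)
  where
  unique : ∀ {n c} → IsSymChain n c → Unique c
  unique {c = []}    _ = []
  unique {c = _ ∷ _} h = path-unique (Sym.path (symChain⇒Sym h))
  disjoint : ∀ {n} (F : SCD n) → AtMostOnce F → AllPairs Disjoint F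
  disjoint []      _    = []
  disjoint (c ∷ F) once = All.tabulate apart′ ∷ disjoint F (λ s i i′ p q → Fin.suc-injective (once s (suc i) (suc i′) p q))
    where
    apart′ : ∀ {D} → D ∈ F → Disjoint c D
    apart′ D∈ (s∈c , s∈D) with once _ zero (suc (index D∈)) s∈c (subst (_ ∈_) (lookup-index D∈) s∈D)
    ... | ()

unique-++⁻ʳ : {X : Set} (c : List X) {L : List X} → Unique (c ++ L) → Unique L
unique-++⁻ʳ []      u       = u
unique-++⁻ʳ (_ ∷ c) (_ ∷ u) = unique-++⁻ʳ c u

unique⇒atMostOnce : ∀ {n} (F : SCD n) → Unique (concat F) → AtMostOnce F
unique⇒atMostOnce (c ∷ F) u s zero    zero     p q = refl
unique⇒atMostOnce (c ∷ F) u s (suc i) (suc i′) p q =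
  cong suc (unique⇒atMostOnce F (unique-++⁻ʳ c u) s i i′ p q)
unique⇒atMostOnce (c ∷ F) u s zero    (suc i′) p q =
  ⊥-elim (disjoint-++ c u p (∈-concat⁺′ q (∈-lookup {xs = F} i′)))
  where
  disjoint-++ : ∀ {X : Set} {L : List X} c {s} → Unique (c ++ L) → s ∈ c → s ∈ L → ⊥
  disjoint-++ (_ ∷ c) (s∉ ∷ _) (here refl) t = All.lookup s∉ (∈-++⁺ʳ c t) refl
  disjoint-++ (_ ∷ c) (_ ∷ u)  (there p)   t = disjoint-++ c u p t
unique⇒atMostOnce (c ∷ F) u s (suc i) zero p q = sym (unique⇒atMostOnce (c ∷ F) u s zero (suc i) q p)

unique-↭ : {X : Set} {L L′ : List X} → L ↭ L′ → Unique L → Unique L′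
unique-↭ p = ↭ₛ.Unique-resp-↭ (setoid _) (↭⇒↭ₛ p)

∣++∣ : ∀ {m n} (s : Subset m) (t : Subset n) → ∣ s Vec.++ t ∣ ≡ ∣ s ∣ + ∣ t ∣
∣++∣ Vec.[]            t = refl
∣++∣ (true Vec.∷ s)  t = cong suc (∣++∣ s t)
∣++∣ (false Vec.∷ s) t = ∣++∣ s t

++-monoʳ : ∀ {m n} (s : Subset m) {t t′ : Subset n} → t ⊆ t′ → s Vec.++ t ⊆ s Vec.++ t′
++-monoʳ Vec.[]      t⊆ = t⊆
++-monoʳ (_ Vec.∷ s) t⊆ = s⊆s (++-monoʳ s t⊆)

++-monoˡ : ∀ {m n} (s s′ : Subset m) (t : Subset n) → s ⊆ s′ → s Vec.++ t ⊆ s′ Vec.++ t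
++-monoˡ Vec.[] Vec.[] t _ x∈ = x∈
++-monoˡ (false Vec.∷ s) (b Vec.∷ s′) t s⊆ = out⊆ (++-monoˡ s s′ t (drop-∷-⊆ s⊆))
++-monoˡ (true Vec.∷ s) (b Vec.∷ s′) t s⊆ with s⊆ Vec.here
... | Vec.here = s⊆s (++-monoˡ s s′ t (drop-∷-⊆ s⊆))

join : ∀ {m n p} → Carrier (Cube m ⊗ (Cube n ⊗ Cube p)) → Subset (m + n + p)
join (a , b , c) = (a Vec.++ b) Vec.++ c

split : ∀ m n p → Subset (m + n + p) → Carrier (Cube m ⊗ (Cube n ⊗ Cube p))
split m n p s = π₁ {m} {n} {p} s , π₂ {m} {n} {p} s , π₃ {m} {n} {p} s

join-split : ∀ {m n p} s → join (split m n p s) ≡ s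
join-split {m} {n} {p} s = trans (cong (Vec._++ Vec.drop (m + n) s) (Vec.take++drop≡id m (Vec.take (m + n) s))) (Vec.take++drop≡id (m + n) s)

join-injective : ∀ {m n p} {P Q : Carrier (Cube m ⊗ (Cube n ⊗ Cube p))} → join P ≡ join Q → P ≡ Q
join-injective {P = a , b , c} {a′ , b′ , c′} eq
  with Vec.++-injective (a Vec.++ b) (a′ Vec.++ b′) eq
... | ab , refl with Vec.++-injective a a′ ab
...   | refl , refl = refl

split-join : ∀ {m n p} P → split m n p (join P) ≡ P
split-join {m} {n} {p} P = join-injective (join-split {m} {n} {p} (join P))

join-⋖ : ∀ {m n p P Q} → Cover (Cube m) (Cube n ⊗ Cube p) P Q → Graded._⋖_ (Cube (m + n + p)) (join P) (join Q)
join-⋖ {P = a , b , c} (left {x′ = a′} (a⊆ , e)) =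
  ++-monoˡ _ _ c (++-monoˡ a a′ b a⊆) ,
  trans (∣++∣ (a′ Vec.++ b) c) (trans (cong (_+ ∣ c ∣) (trans (∣++∣ a′ b) (trans (cong (_+ ∣ b ∣) e) (cong suc (sym (∣++∣ a b))))))
    (cong suc (sym (∣++∣ (a Vec.++ b) c))))
join-⋖ {P = a , b , c} (right (left {x′ = b′} (b⊆ , e))) =
  ++-monoˡ _ _ c (++-monoʳ a b⊆) ,
  trans (∣++∣ (a Vec.++ b′) c) (trans (cong (_+ ∣ c ∣) (trans (∣++∣ a b′) (trans (cong (∣ a ∣ +_) e) (trans (+-suc ∣ a ∣ ∣ b ∣) (cong suc (sym (∣++∣ a b)))))))
    (cong suc (sym (∣++∣ (a Vec.++ b) c))))
join-⋖ {P = a , b , c} (right (right {y′ = c′} (c⊆ , e))) =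
  ++-monoʳ (a Vec.++ b) c⊆ ,
  trans (∣++∣ (a Vec.++ b) c′) (trans (cong (∣ a Vec.++ b ∣ +_) e) (trans (+-suc ∣ a Vec.++ b ∣ ∣ c ∣) (cong suc (sym (∣++∣ (a Vec.++ b) c)))))

join-rank : ∀ {m n p} (P : Carrier (Cube m ⊗ (Cube n ⊗ Cube p))) →
            ∣ join P ∣ ≡ Graded.rank (Cube m ⊗ (Cube n ⊗ Cube p)) P
join-rank (a , b , c) = trans (∣++∣ (a Vec.++ b) c) (trans (cong (_+ ∣ c ∣) (∣++∣ a b)) (+-assoc (∣ a ∣) (∣ b ∣) (∣ c ∣)))

-- Families of almost orthogonal decompositions

_∈ˢ?_ : ∀ {n} (s : Subset n) (c : Chain n) → Dec (s ∈ c)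
_∈ˢ?_ = DecMem._∈?_ _≟ˢ_

two-distinct : {X : Set} {u v : X} {c : List X} → u ∈ c → v ∈ c → u ≢ v → 2 ≤ length c
two-distinct (here refl) (here refl) n = ⊥-elim (n refl)
two-distinct {c = _ ∷ _ ∷ _} _ _ _ = s≤s (s≤s z≤n)
two-distinct {c = _ ∷ []} (here refl) (there ()) n
two-distinct {c = _ ∷ []} (there ()) _ n

three-distinct : {X : Set} {u v w : X} {c : List X} → u ∈ c → v ∈ c → w ∈ c →
                 u ≢ v → u ≢ w → v ≢ w → 3 ≤ length c
three-distinct (here refl) (here refl) _ uv _ _ = ⊥-elim (uv refl)
three-distinct (here refl) (there _) (here refl) _ uw _ = ⊥-elim (uw refl)
three-distinct (here refl) (there v∈) (there w∈) _ _ vw = s≤s (two-distinct v∈ w∈ vw)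
three-distinct (there u∈) (here refl) (here refl) _ _ vw = ⊥-elim (vw refl)
three-distinct (there u∈) (here refl) (there w∈) _ uw _ = s≤s (two-distinct u∈ w∈ uw)
three-distinct (there u∈) (there v∈) (here refl) uv _ _ = s≤s (two-distinct u∈ v∈ uv)
three-distinct (there u∈) (there v∈) (there w∈) uv uw vw = m≤n⇒m≤1+n (three-distinct u∈ v∈ w∈ uv uw vw)

∅≢full : ∀ {n} → 1 ≤ n → ∅ {n} ≢ ⊤ˢ
∅≢full {n} l e = <-irrefl (trans (sym (∣⊥∣≡0 n)) (trans (cong ∣_∣ e) (∣⊤∣≡n n))) l

HasEnds : ∀ {n} → Chain n → Set
HasEnds c = ∅ ∈ c × ⊤ˢ ∈ c

Corners : ∀ {n} → Subset n → Subset n → Set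
Corners u v = u ≡ ∅ × v ≡ ⊤ˢ

-- Two distinct common members already exceed the bound 1, so both chains contain ∅ and the full
-- set; then any third common member would exceed the bound 2.
meet : ∀ {n} {F G : SCD n} {A B u v} → 1 ≤ n → AlmostOrthogonal F G → A ∈ F → B ∈ G →
       u ∈ A → u ∈ B → v ∈ A → v ∈ B →
       u ≡ v ⊎ ((HasEnds A × HasEnds B) × (Corners u v ⊎ Corners v u))
meet {n} {A = A} {B} {u} {v} 1≤n ao A∈ B∈ uA uB vA vB with u ≟ˢ v
... | yes u≡v = inj₁ u≡v
... | no u≢v with ((∅ ∈ˢ? A) ×-dec (⊤ˢ ∈ˢ? A)) ×-dec ((∅ ∈ˢ? B) ×-dec (⊤ˢ ∈ˢ? B))
...   | no ¬full = ⊥-elim (<-irrefl refl (≤-trans (two-distinct (both uA uB) (both vA vB) u≢v) (proj₂ (ao A B A∈ B∈) ¬full)))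
  where
  both : ∀ {w} → w ∈ A → w ∈ B → w ∈ filter (_∈ˢ? B) A
  both wA wB = ∈-filter⁺ (_∈ˢ? B) wA wB
...   | yes f@((∅A , ⊤A) , (∅B , ⊤B)) = inj₂ (f , corners (end uA uB) (end vA vB))
  where
  both : ∀ {w} → w ∈ A → w ∈ B → w ∈ filter (_∈ˢ? B) A
  both wA wB = ∈-filter⁺ (_∈ˢ? B) wA wB
  end : ∀ {w} → w ∈ A → w ∈ B → w ≡ ∅ ⊎ w ≡ ⊤ˢ
  end {w} wA wB with w ≟ˢ ∅ | w ≟ˢ ⊤ˢ
  ... | yes e | _     = inj₁ e
  ... | no _  | yes e = inj₂ e
  ... | no a  | no b  = ⊥-elim (<-irrefl refl (≤-trans
    (three-distinct (both wA wB) (both ∅A ∅B) (both ⊤A ⊤B) a b (∅≢full 1≤n))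
    (≤-reflexive (proj₁ (ao A B A∈ B∈) f))))
  corners : u ≡ ∅ ⊎ u ≡ ⊤ˢ → v ≡ ∅ ⊎ v ≡ ⊤ˢ → Corners u v ⊎ Corners v u
  corners (inj₁ refl) (inj₁ refl) = ⊥-elim (u≢v refl)
  corners (inj₁ u≡)   (inj₂ v≡)   = inj₁ (u≡ , v≡)
  corners (inj₂ u≡)   (inj₁ v≡)   = inj₂ (v≡ , u≡)
  corners (inj₂ refl) (inj₂ refl) = ⊥-elim (u≢v refl)

even-odd-⊥ : ∀ {n} → Even n → Odd n → ⊥
even-odd-⊥ (t , refl) (r , e) = even≢odd t r e

length-1⇒even : ∀ {n c} → IsSymChain n c → length c ≡ 1 → Even n
length-1⇒even (_ , j , len , _) l = j , suc-injective (trans (sym len) (cong (_+ 2 * j) l))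

length-2⇒odd : ∀ {n c} → IsSymChain n c → length c ≡ 2 → Odd n
length-2⇒odd (_ , j , len , _) l = j , suc-injective (trans (sym len) (cong (_+ 2 * j) l))

nonempty-path : ∀ {n A u} → IsSymChain n A → u ∈ A → Sym (Cube n) n A
nonempty-path {A = _ ∷ _} h _ = symChain⇒Sym h

bottom-unique : ∀ {G x z c u} → Path G x z c → u ∈ c → Graded.rank G u ≡ 0 → u ≡ x
bottom-unique [-]         (here refl) _ = refl
bottom-unique (e ∷ p)     (here refl) _ = refl
bottom-unique {G} (e ∷ p) (there u∈)  r = ⊥-elim (n≮0 (≤-trans (All.lookup (rank-< e p) u∈) (≤-reflexive r)))

top-unique : ∀ {G x z c u} → Path G x z c → u ∈ c → Graded.rank G z ≤ Graded.rank G u → u ≡ z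
top-unique [-]         (here refl) _ = refl
top-unique (e ∷ p)     (here refl) r = ⊥-elim (<-irrefl refl (≤-trans (All.lookup (rank-< e p) (last-∈ p)) r))
top-unique (e ∷ p)     (there u∈)  r = top-unique p u∈ r

module _ {n : ℕ} {A : Chain n} {x z : Subset n} (p : Path (Cube n) x z A) (h : HasEnds A) where
  ends-bot : ∅ ≡ x
  ends-bot = bottom-unique p (proj₁ h) (∣⊥∣≡0 n)

  ends-top : ⊤ˢ ≡ z
  ends-top = top-unique p (proj₂ h) (≤-trans (∣p∣≤n z) (≤-reflexive (sym (∣⊤∣≡n n))))

  ends-length : length A ≡ suc n
  ends-length = begin
    length A               ≡⟨ sym (+-identityʳ _) ⟩
    length A + 0           ≡⟨ cong (length A +_) (sym (trans (cong ∣_∣ (sym ends-bot)) (∣⊥∣≡0 n))) ⟩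
    length A + ∣ x ∣       ≡⟨ path-length p ⟩
    suc ∣ z ∣              ≡⟨ cong suc (trans (cong ∣_∣ (sym ends-top)) (∣⊤∣≡n n)) ⟩
    suc n ∎
    where open ≡-Reasoning

record Family (n k : ℕ) (F : Fin k → SCD n) : Set where
  field
    4≤n      : 4 ≤ n
    pao      : IsPAOFamily n k F
    priority : ℕ
    prio≤2   : priority ≤ 2
    good     : Good n k F ⊎ (Odd n × priority ≡ 2)

  1≤n : 1 ≤ n
  1≤n = ≤-trans (s≤s z≤n) 4≤n

  symChain : ∀ i {A} → A ∈ F i → IsSymChain n A
  symChain i = All.lookup (proj₁ (proj₁ pao i))

  -- For a 2-element chain containing `b` this says that the edge is oriented away from `b`. Asking
  -- merely for an out-neighbour on the chain avoids a case distinction on which of the two members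
  -- is `b`.
  PointsIn : Chain n → Subset n → Set
  PointsIn A b with good
  ... | inj₁ (inj₂ (_ , Out , _)) = ∃ λ b′ → b′ ∈ A × b ≢ b′ × Out b ≡ just b′
  ... | inj₁ (inj₁ _)             = ⊥
  ... | inj₂ _                    = ⊥

  line : ∀ {x z A} → Path (Cube n) x z A → Line (Cube n)
  line {A = A} p = record
    { pts  = A
    ; path = p
    ; Jump = λ u v → HasEnds A × Corners u v
    ; Tail = PointsIn A
    ; prio = priority
    }

  -- Out-degree at most 1 makes the out-neighbour of `b` on `A` and on `B` the same vertex. The
  -- chains then share two distinct members, so `A` would reach from ∅ to the full set and have more
  -- than two elements.
  points-conflict : ∀ {i j} → i ≢ j → ∀ {A B b} → A ∈ F i → B ∈ F j → b ∈ A → b ∈ B → length A ≤ 2 →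
                    PointsIn A b → PointsIn B b → ⊥
  points-conflict {i} {j} i≢j {A} A∈ B∈ bA bB lA τ τ′ with good
  points-conflict {i} {j} i≢j {A} A∈ B∈ bA bB lA (b′ , b′A , b≢b′ , o) (b″ , b″B , _ , o″) | inj₁ (inj₂ (_ , Out , _))
    with just-injective (trans (sym o) o″)
  ... | refl with meet 1≤n (proj₂ pao i j i≢j) A∈ B∈ bA bB b′A b″B
  ...   | inj₁ b≡b′ = b≢b′ b≡b′
  ...   | inj₂ ((hA , _) , _) with nonempty-path (symChain i A∈) bA
  ...     | symmetric p _ = <-irrefl refl
    (≤-trans (s≤s (≤-trans (≤-trans (n≤1+n 2) (n≤1+n 3)) 4≤n)) (≤-trans (≤-reflexive (sym (ends-length p hA))) lA))

  -- A singleton chain makes the dimension even, and then no symmetric chain has two members. Hence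
  -- `B` is the same singleton, which goodness rules out.
  single-conflict : ∀ {i j} → i ≢ j → ∀ {A B b} → A ∈ F i → B ∈ F j → b ∈ A → b ∈ B →
                    length A ≡ 1 → length B ≤ 2 → ⊥
  single-conflict {i} {j} i≢j {A} {B} {b} A∈ B∈ bA bB lA lB = go good
    where
    even : Even n
    even = length-1⇒even (symChain i A∈) lA
    one : ∀ {c : Chain n} → b ∈ c → length c ≡ 1 → c ≡ [ b ]
    one {_ ∷ []} (here refl) _ = refl
    lB≡1 : length B ≡ 1
    lB≡1 = count B∈ bB lB
      where
      count : ∀ {c} → c ∈ F j → b ∈ c → length c ≤ 2 → length c ≡ 1
      count {_ ∷ []}        _ _ _ = refl
      count {_ ∷ _ ∷ []}    c∈ _ _ = ⊥-elim (even-odd-⊥ even (length-2⇒odd (symChain j c∈) refl))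
      count {_ ∷ _ ∷ _ ∷ _} _ _ (s≤s (s≤s ()))
    go : Good n k F ⊎ (Odd n × priority ≡ 2) → ⊥
    go (inj₁ (inj₁ (_ , distinct))) = distinct i j i≢j A B A∈ B∈ lA lB≡1 (trans (one bA lA) (sym (one bB lB≡1)))
    go (inj₁ (inj₂ (odd , _)))      = even-odd-⊥ even odd
    go (inj₂ (odd , _))             = even-odd-⊥ even odd

  shape : ∀ i {x z A} → A ∈ F i → (p : Path (Cube n) x z A) → Shape (line p)
  shape i {x} {z} {A} A∈ p with (∅ ∈ˢ? A) ×-dec (⊤ˢ ∈ˢ? A)
  ... | yes h = full (λ { (_ , refl , refl) → ends-bot p h , ends-top p h })
                     (≤-trans (s≤s 4≤n) (≤-reflexive (sym (ends-length p h))))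
  ... | no ¬h = by-length p A∈ (λ j → ¬h (proj₁ j))
    where
    tails : ∀ {x z} → x ≢ z → (x ∷ z ∷ []) ∈ F i → priority < 2 → PointsIn (x ∷ z ∷ []) x ⊎ PointsIn (x ∷ z ∷ []) z
    tails x≢z A∈ lt with good
    ... | inj₁ (inj₁ (even , _)) = ⊥-elim (even-odd-⊥ even (length-2⇒odd (symChain i A∈) refl))
    ... | inj₂ (_ , e) = ⊥-elim (<-irrefl e lt)
    ... | inj₁ (inj₂ (_ , Out , _ , oriented)) with oriented i _ _ A∈
    ...   | inj₁ o = inj₁ (_ , there (here refl) , x≢z , o)
    ...   | inj₂ o = inj₂ (_ , here refl , x≢z ∘ sym , o)
    by-length : ∀ {x z A} (p : Path (Cube n) x z A) → A ∈ F i → Flat (line p) → Shape (line p)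
    by-length [-] A∈ f = single f refl
    by-length p@(e ∷ [-]) A∈ f = couple f refl (tails (All.head (head≢tail p)) A∈)
    by-length (e ∷ e′ ∷ [-]) A∈ f = long f (s≤s (s≤s (s≤s z≤n)))
    by-length (e ∷ e′ ∷ (_ ∷ _)) A∈ f = long f (s≤s (s≤s (s≤s z≤n)))

open Family public using (priority; 4≤n; 1≤n; pao; symChain; line)

-- If no singleton is involved, the order of the priorities is the same for `i` and `j`. Both
-- exceptions therefore refer to the tail in the same family, where `points-conflict` applies.
thin-conflict : ∀ {n p k G H} (𝒢 : Family n k G) (ℋ : Family p k H) {i j : Fin k} → i ≢ j →
  ∀ {B B′ C C′ x z x′ z′ y w y′ w′ b c}
  (pB : Path (Cube n) x z B) (pB′ : Path (Cube n) x′ z′ B′) (pC : Path (Cube p) y w C) (pC′ : Path (Cube p) y′ w′ C′) →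
  B ∈ G i → B′ ∈ G j → C ∈ H i → C′ ∈ H j → b ∈ B → b ∈ B′ → c ∈ C → c ∈ C′ →
  Thin (line 𝒢 pB) (line ℋ pC) b c → Thin (line 𝒢 pB′) (line ℋ pC′) b c → ⊥
thin-conflict 𝒢 ℋ i≢j pB pB′ pC pC′ B∈ B′∈ C∈ C′∈ bB bB′ cC cC′ (lB , lC , s) (lB′ , lC′ , s′) = go s s′
  where
  go : _ → _ → ⊥
  go (inj₁ l) _ = Family.single-conflict 𝒢 i≢j B∈ B′∈ bB bB′ l lB′
  go (inj₂ (inj₁ l)) _ = Family.single-conflict ℋ i≢j C∈ C′∈ cC cC′ l lC′
  go _ (inj₁ l) = Family.single-conflict 𝒢 (i≢j ∘ sym) B′∈ B∈ bB′ bB l lB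
  go _ (inj₂ (inj₁ l)) = Family.single-conflict ℋ (i≢j ∘ sym) C′∈ C∈ cC′ cC l lC
  go (inj₂ (inj₂ (inj₁ (_ , τ)))) (inj₂ (inj₂ (inj₁ (_ , τ′)))) = Family.points-conflict 𝒢 i≢j B∈ B′∈ bB bB′ lB τ τ′
  go (inj₂ (inj₂ (inj₂ (_ , τ)))) (inj₂ (inj₂ (inj₂ (_ , τ′)))) = Family.points-conflict ℋ i≢j C∈ C′∈ cC cC′ lC τ τ′
  go (inj₂ (inj₂ (inj₁ (lt , _)))) (inj₂ (inj₂ (inj₂ (gt , _)))) = <-asym lt gt
  go (inj₂ (inj₂ (inj₂ (lt , _)))) (inj₂ (inj₂ (inj₁ (gt , _)))) = <-asym lt gt

-- Lower bound for the dimension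

path-next : ∀ {G x z c u} → Path G x z c → u ∈ c → u ≢ z → ∃ λ v → v ∈ c × Graded._⋖_ G u v
path-next [-]     (here refl) u≢z = ⊥-elim (u≢z refl)
path-next (e ∷ p) (here refl) u≢z = _ , there (head-∈ p) , e
path-next (e ∷ p) (there u∈)  u≢z with path-next p u∈ u≢z
... | v , v∈ , f = v , there v∈ , f

-- A set below the middle level extends to one of its upper covers in each decomposition, and
-- different decompositions use different covers.
two-covers-⊥ : ∀ {n k F} → IsPAOFamily n k F → 2 ≤ n → 3 ≤ k → (s t₁ t₂ : Subset n) → ∣ s ∣ + ∣ s ∣ < n →
               (∀ {t} → Graded._⋖_ (Cube n) s t → t ≡ t₁ ⊎ t ≡ t₂) → ⊥
two-covers-⊥ {n} {suc (suc (suc k))} {F} (scd , ao) 2≤n (s≤s (s≤s (s≤s z≤n))) s t₁ t₂ low covers =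
  pigeonhole zero (suc zero) (suc (suc zero)) (λ ()) (λ ()) (λ ()) (which zero) (which (suc zero)) (which (suc (suc zero)))
  where
  Uses : Fin (suc (suc (suc k))) → Subset n → Set
  Uses i t = ∃ λ A → A ∈ F i × s ∈ A × t ∈ A × Graded._⋖_ (Cube n) s t
  which : ∀ i → Uses i t₁ ⊎ Uses i t₂
  which i with proj₁ (proj₂ (scd i) s)
  ... | l , s∈ with nonempty-path (All.lookup (proj₁ (scd i)) (∈-lookup l)) s∈
  -- If `s` were the top of its chain, the bottom would have at most ∣ s ∣ elements, and by symmetry
  -- n ≤ 2 ∣ s ∣, contrary to `low`.
  ...   | symmetric {x} p b with path-next p s∈ (λ { refl → <-irrefl refl
            (≤-trans low (≤-trans (≤-reflexive (sym b)) (+-monoˡ-≤ ∣ s ∣ (All.lookup (rank-≥ p) s∈)))) })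
  ...     | t , t∈ , e with covers e
  ...       | inj₁ refl = inj₁ (_ , ∈-lookup l , s∈ , t∈ , e)
  ...       | inj₂ refl = inj₂ (_ , ∈-lookup l , s∈ , t∈ , e)
  clash : ∀ {i j t} → i ≢ j → Uses i t → Uses j t → ⊥
  clash {i} {j} {t} i≢j (A , A∈ , sA , tA , e) (B , B∈ , sB , tB , _)
    with meet (≤-trans (s≤s z≤n) 2≤n) (ao i j i≢j) A∈ B∈ sA sB tA tB
  ... | inj₁ refl = <-irrefl refl (≤-reflexive (sym (proj₂ e)))
  ... | inj₂ (_ , inj₁ (refl , refl)) = <-irrefl refl
    (≤-trans 2≤n (≤-reflexive (trans (sym (∣⊤∣≡n n)) (trans (proj₂ e) (cong suc (∣⊥∣≡0 n))))))
  ... | inj₂ (_ , inj₂ (refl , refl)) with trans (sym (∣⊥∣≡0 n)) (proj₂ e)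
  ...   | ()
  pigeonhole : ∀ i j l → i ≢ j → i ≢ l → j ≢ l → Uses i t₁ ⊎ Uses i t₂ → Uses j t₁ ⊎ Uses j t₂ → Uses l t₁ ⊎ Uses l t₂ → ⊥
  pigeonhole i j l ij il jl (inj₁ u) (inj₁ v) _        = clash ij u v
  pigeonhole i j l ij il jl (inj₂ u) (inj₂ v) _        = clash ij u v
  pigeonhole i j l ij il jl (inj₁ u) (inj₂ v) (inj₁ w) = clash il u w
  pigeonhole i j l ij il jl (inj₁ u) (inj₂ v) (inj₂ w) = clash jl v w
  pigeonhole i j l ij il jl (inj₂ u) (inj₁ v) (inj₁ w) = clash jl v w
  pigeonhole i j l ij il jl (inj₂ u) (inj₁ v) (inj₂ w) = clash il u w

dimension≥4 : ∀ {n k F} → IsPAOFamily n k F → 2 ≤ n → 3 ≤ k → 4 ≤ n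
dimension≥4 {suc (suc (suc (suc n)))} _ _ _ = s≤s (s≤s (s≤s (s≤s z≤n)))
dimension≥4 {1} _ (s≤s ()) _
dimension≥4 {2} {F = F} pao l 3≤k = ⊥-elim
  (two-covers-⊥ {F = F} pao l 3≤k (false Vec.∷ false Vec.∷ Vec.[]) (true Vec.∷ false Vec.∷ Vec.[]) (false Vec.∷ true Vec.∷ Vec.[])
    (s≤s z≤n) covers)
  where
  covers : ∀ {t} → Graded._⋖_ (Cube 2) (false Vec.∷ false Vec.∷ Vec.[]) t → _
  covers {true  Vec.∷ false Vec.∷ Vec.[]} _ = inj₁ refl
  covers {false Vec.∷ true  Vec.∷ Vec.[]} _ = inj₂ refl
  covers {true  Vec.∷ true  Vec.∷ Vec.[]} (_ , ())
  covers {false Vec.∷ false Vec.∷ Vec.[]} (_ , ())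
-- In dimension 3 the empty set has three upper covers, enough for three decompositions. A singleton
-- still lies below the middle and has only two.
dimension≥4 {3} {F = F} pao l 3≤k = ⊥-elim
  (two-covers-⊥ {F = F} pao l 3≤k (true Vec.∷ false Vec.∷ false Vec.∷ Vec.[])
    (true Vec.∷ true Vec.∷ false Vec.∷ Vec.[]) (true Vec.∷ false Vec.∷ true Vec.∷ Vec.[])
    (s≤s (s≤s (s≤s z≤n))) covers)
  where
  covers : ∀ {t} → Graded._⋖_ (Cube 3) (true Vec.∷ false Vec.∷ false Vec.∷ Vec.[]) t → _
  covers {true Vec.∷ true  Vec.∷ false Vec.∷ Vec.[]} _ = inj₁ refl
  covers {true Vec.∷ false Vec.∷ true  Vec.∷ Vec.[]} _ = inj₂ refl
  covers {true Vec.∷ true  Vec.∷ true  Vec.∷ Vec.[]} (_ , ())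
  covers {true Vec.∷ false Vec.∷ false Vec.∷ Vec.[]} (_ , ())
  covers {false Vec.∷ _} (s⊆t , _) with s⊆t Vec.here
  ... | ()

-- Sizes of intersections and regrouping of boxes

comparable : ∀ {G x z c} {R : Carrier G → Carrier G → Set} → (∀ {u} → R u u) → (∀ {u v w} → R u v → R v w → R u w) →
             (∀ {u v} → Graded._⋖_ G u v → R u v) → Path G x z c →
             ∀ {u v} → u ∈ c → v ∈ c → R u v ⊎ R v u
comparable {G} {R = R} rfl tr up = go
  where
  above : ∀ {x z c} → Path G x z c → All (R x) c
  above [-]     = rfl ∷ []
  above (e ∷ p) = rfl ∷ All.map (tr (up e)) (above p)
  go : ∀ {x z c} → Path G x z c → ∀ {u v} → u ∈ c → v ∈ c → R u v ⊎ R v u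
  go p@([-])   (here refl) v∈          = inj₁ (All.lookup (above p) v∈)
  go p@(_ ∷ _) (here refl) v∈          = inj₁ (All.lookup (above p) v∈)
  go p@(_ ∷ _) (there u∈)  (here refl) = inj₂ (All.lookup (above p) (there u∈))
  go (_ ∷ p)   (there u∈)  (there v∈)  = go p u∈ v∈

length≤1 : {X : Set} {l : List X} → Unique l → (∀ {u v} → u ∈ l → v ∈ l → u ≡ v) → length l ≤ 1
length≤1 {l = []}        _              _ = z≤n
length≤1 {l = _ ∷ []}    _              _ = s≤s z≤n
length≤1 {l = _ ∷ _ ∷ _} ((n ∷ _) ∷ _) e = ⊥-elim (n (e (here refl) (there (here refl))))

length≡2 : {X : Set} {l : List X} {x y : X} → Unique l → x ∈ l → y ∈ l → x ≢ y →
           (∀ {u} → u ∈ l → u ≡ x ⊎ u ≡ y) → length l ≡ 2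
length≡2 {l = []} _ () _ _ _
length≡2 {l = _ ∷ []} _ (here refl) (here refl) n _ = ⊥-elim (n refl)
length≡2 {l = _ ∷ _ ∷ []} _ _ _ _ _ = refl
length≡2 {l = u ∷ v ∷ w ∷ _} ((uv ∷ uw ∷ _) ∷ (vw ∷ _) ∷ _) _ _ _ e
  with e (here refl) | e (there (here refl)) | e (there (there (here refl)))
... | inj₁ a | inj₁ b | _      = ⊥-elim (uv (trans a (sym b)))
... | inj₂ a | inj₂ b | _      = ⊥-elim (uv (trans a (sym b)))
... | inj₁ a | inj₂ b | inj₁ c = ⊥-elim (uw (trans a (sym c)))
... | inj₁ a | inj₂ b | inj₂ c = ⊥-elim (vw (trans b (sym c)))
... | inj₂ a | inj₁ b | inj₁ c = ⊥-elim (vw (trans b (sym c)))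
... | inj₂ a | inj₁ b | inj₂ c = ⊥-elim (uw (trans a (sym c)))

-- Converse of `meet`: the description of the common members is turned back into the two counts of
-- almost orthogonality. Since `A` has no repetitions, counting list entries is counting sets.
intersection-size : ∀ {n} {A B : Chain n} → 1 ≤ n → Unique A →
  (∀ {s t} → s ∈ A → s ∈ B → t ∈ A → t ∈ B → s ≡ t ⊎ (Corners s t ⊎ Corners t s)) →
  (BothFull A B → ∣ A ∩ B ∣ ≡ 2) × (¬ BothFull A B → ∣ A ∩ B ∣ ≤ 1)
intersection-size {A = A} {B} 1≤n u key = size₂ , size₁
  where
  meeting : ∀ {s t} → s ∈ filter (_∈ˢ? B) A → t ∈ filter (_∈ˢ? B) A → s ≡ t ⊎ (Corners s t ⊎ Corners t s)
  meeting s∈ t∈ with ∈-filter⁻ (_∈ˢ? B) {xs = A} s∈ | ∈-filter⁻ (_∈ˢ? B) {xs = A} t∈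
  ... | sA , sB | tA , tB = key sA sB tA tB
  size₂ : BothFull A B → ∣ A ∩ B ∣ ≡ 2
  size₂ ((∅A , ⊤A) , (∅B , ⊤B)) =
    length≡2 (Unique.filter⁺ (_∈ˢ? B) u) ∅∈ (∈-filter⁺ (_∈ˢ? B) ⊤A ⊤B) (∅≢full 1≤n) (λ s∈ → corner (meeting ∅∈ s∈))
    where
    ∅∈ = ∈-filter⁺ (_∈ˢ? B) ∅A ∅B
    corner : ∀ {s} → ∅ ≡ s ⊎ (Corners ∅ s ⊎ Corners s ∅) → s ≡ ∅ ⊎ s ≡ ⊤ˢ
    corner (inj₁ e)              = inj₁ (sym e)
    corner (inj₂ (inj₁ (_ , e))) = inj₂ e
    corner (inj₂ (inj₂ (e , _))) = inj₁ e
  size₁ : ¬ BothFull A B → ∣ A ∩ B ∣ ≤ 1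
  size₁ ¬full = length≤1 (Unique.filter⁺ (_∈ˢ? B) u) λ s∈ t∈ → equal s∈ t∈ (meeting s∈ t∈)
    where
    both : ∀ {s t} → Corners s t → s ∈ filter (_∈ˢ? B) A → t ∈ filter (_∈ˢ? B) A → BothFull A B
    both (refl , refl) s∈ t∈ with ∈-filter⁻ (_∈ˢ? B) {xs = A} s∈ | ∈-filter⁻ (_∈ˢ? B) {xs = A} t∈
    ... | sA , sB | tA , tB = (sA , tA) , (sB , tB)
    equal : ∀ {s t} → s ∈ filter (_∈ˢ? B) A → t ∈ filter (_∈ˢ? B) A → s ≡ t ⊎ (Corners s t ⊎ Corners t s) → s ≡ t
    equal _  _  (inj₁ e)        = e
    equal s∈ t∈ (inj₂ (inj₁ c)) = ⊥-elim (¬full (both c s∈ t∈))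
    equal s∈ t∈ (inj₂ (inj₂ c)) = ⊥-elim (¬full (both c t∈ s∈))

concatMap-⊠ : {X Y W : Set} (h : W → List Y) (F : List (List X)) (L : List W) →
              concatMap (λ t → proj₁ t ⊠ h (proj₂ t)) (F ⊠ L) ↭ concat F ⊠ concatMap h L
concatMap-⊠ h []      L = ↭-refl
concatMap-⊠ h (A ∷ F) L = begin
  concatMap g (col A L ++ F ⊠ L)                ≡⟨ concatMap-++ g (col A L) (F ⊠ L) ⟩
  concatMap g (col A L) ++ concatMap g (F ⊠ L)  ↭⟨ ++⁺ (slice L) (concatMap-⊠ h F L) ⟩
  A ⊠ concatMap h L ++ concat F ⊠ concatMap h L ≡⟨ sym (cartesianProductWith-distribʳ-++ _,_ A (concat F) _) ⟩
  (A ++ concat F) ⊠ concatMap h L ∎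
  where
  open PermutationReasoning
  g = λ t → proj₁ t ⊠ h (proj₂ t)
  slice : ∀ L → concatMap g (col A L) ↭ A ⊠ concatMap h L
  slice []      = ↭-reflexive (sym (cartesianProductWith-zeroʳ _,_ A))
  slice (w ∷ L) = ↭-trans (++⁺ˡ (A ⊠ h w) (slice L)) (↭-sym (⊠-distribˡ-++ A (h w) (concatMap h L)))

constant-++ : ∀ {X : Set} (x : X) m n → Vec.replicate m x Vec.++ Vec.replicate n x ≡ Vec.replicate (m + n) x
constant-++ x zero    n = refl
constant-++ x (suc m) n = cong (x Vec.∷_) (constant-++ x m n)

join-constant : ∀ b m n p → join (Vec.replicate m b , Vec.replicate n b , Vec.replicate p b) ≡ Vec.replicate (m + n + p) b
join-constant b m n p = trans (cong (Vec._++ Vec.replicate p b) (constant-++ b m n)) (constant-++ b (m + n) p)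

-- The product decompositions

module Combine {m n p k : ℕ} {F : Fin k → SCD m} {G : Fin k → SCD n} {H : Fin k → SCD p}
               (𝓕 : Family m k F) (𝓖 : Family n k G) (ℋ : Family p k H)
               (𝓕≢𝓖 : priority 𝓕 ≢ priority 𝓖) (𝓕≢ℋ : priority 𝓕 ≢ priority ℋ) (𝓖≢ℋ : priority 𝓖 ≢ priority ℋ) where

  Grid : Graded
  Grid = Cube m ⊗ (Cube n ⊗ Cube p)

  Cell : Set
  Cell = Chain m × (Chain n × Chain p)

  cells : Fin k → List Cell
  cells i = F i ⊠ (G i ⊠ H i)

  box : Cell → List (Carrier Grid)
  box (A , B , C) = A ⊠ (B ⊠ C)

  record Piece (i : Fin k) (cell : Cell) (E : List (Carrier Grid)) : Set where
    A = proj₁ cell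
    B = proj₁ (proj₂ cell)
    C = proj₂ (proj₂ cell)
    field
      A∈     : A ∈ F i
      B∈     : B ∈ G i
      C∈     : C ∈ H i
      {x z}  : Subset m
      {y w}  : Subset n
      {u v}  : Subset p
      pA     : Path (Cube m) x z A
      pB     : Path (Cube n) y w B
      pC     : Path (Cube p) u v C
      inside : ∀ {P} → P ∈ E → P ∈ box cell
      sym-E  : Sym Grid (m + (n + p)) E
      sep    : Pairs (Separated (line 𝓕 pA) (line 𝓖 pB) (line ℋ pC)) E

  cut : ∀ i {cell} → cell ∈ cells i → ∃ λ 𝓓 → concat 𝓓 ↭ box cell × All (Piece i cell) 𝓓
  -- A decomposition in odd dimension may list empty chains; their boxes contribute nothing.
  cut i {[] , B , C} _ = [] , ↭-refl , []
  cut i {A@(_ ∷ _) , [] , C} _ = [] , ↭-reflexive (sym (cartesianProductWith-zeroʳ _,_ A)) , []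
  cut i {A@(_ ∷ _) , B@(_ ∷ _) , []} _ = [] ,
    ↭-reflexive (sym (trans (cong (A ⊠_) (cartesianProductWith-zeroʳ _,_ B)) (cartesianProductWith-zeroʳ _,_ A))) , []
  cut i {A@(_ ∷ _) , B@(_ ∷ _) , C@(_ ∷ _)} cell∈
    with ∈-cartesianProduct⁻ (F i) (G i ⊠ H i) cell∈
  ... | A∈ , BC∈ with ∈-cartesianProduct⁻ (G i) (H i) BC∈
  ... | B∈ , C∈ with symChain⇒Sym (symChain 𝓕 i A∈) | symChain⇒Sym (symChain 𝓖 i B∈) | symChain⇒Sym (symChain ℋ i C∈)
  ... | symmetric pA bA | symmetric pB bB | symmetric pC bC
    with cuboid (line 𝓕 pA) (line 𝓖 pB) (line ℋ pC) 𝓕≢𝓖 𝓕≢ℋ 𝓖≢ℋ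
           (Family.prio≤2 𝓕) (Family.prio≤2 𝓖) (Family.prio≤2 ℋ)
           (Family.shape 𝓕 i A∈ pA) (Family.shape 𝓖 i B∈ pB) (Family.shape ℋ i C∈ pC)
  ... | 𝓓 , q , a = 𝓓 , q , All.tabulate λ {E} E∈ → record
    { A∈ = A∈ ; B∈ = B∈ ; C∈ = C∈ ; pA = pA ; pB = pB ; pC = pC
    ; inside = chain-⊆ 𝓓 q E∈
    ; sym-E  = subst (λ N → Sym Grid N E) (cong₂ _+_ bA (cong₂ _+_ bB bC)) (proj₁ (All.lookup a E∈))
    ; sep    = proj₂ (All.lookup a E∈)
    }

  cut-all : ∀ i → ∃ λ 𝓓 → concat 𝓓 ↭ concatMap box (cells i) × All (λ E → ∃ λ cell → cell ∈ cells i × Piece i cell E) 𝓓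
  cut-all i = gather box (Piece i) (cells i) (cut i)

  pieces : Fin k → List (List (Carrier Grid))
  pieces i = proj₁ (cut-all i)

  piece : ∀ i {E} → E ∈ pieces i → ∃ λ cell → Piece i cell E
  piece i E∈ with All.lookup (proj₂ (proj₂ (cut-all i))) E∈
  ... | cell , _ , r = cell , r

  D : Fin k → SCD (m + n + p)
  D i = map (map join) (pieces i)

  -- Covering and disjointness of `D i` are both read off from this permutation, as the right-hand
  -- side is repetition-free and contains every set.
  D-↭ : ∀ i → concat (D i) ↭ map join (concat (F i) ⊠ (concat (G i) ⊠ concat (H i)))
  D-↭ i = begin
    concat (map (map join) (pieces i))    ≡⟨ concat-map (pieces i) ⟩
    map join (concat (pieces i))          ↭⟨ ↭.map⁺ join (proj₁ (proj₂ (cut-all i))) ⟩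
    map join (concatMap box (cells i))    ↭⟨ ↭.map⁺ join (concatMap-⊠ _ (F i) (G i ⊠ H i)) ⟩
    map join (concat (F i) ⊠ concatMap (λ t → proj₁ t ⊠ proj₂ t) (G i ⊠ H i))
      ↭⟨ ↭.map⁺ join (⊠-congʳ (concat (F i)) (↭-trans (concatMap-⊠ id (G i) (H i))
           (↭-reflexive (cong (λ L → concat (G i) ⊠ concat L) (map-id (H i)))))) ⟩
    map join (concat (F i) ⊠ (concat (G i) ⊠ concat (H i))) ∎
    where open PermutationReasoning

  ∈-concat : ∀ {n} {F : SCD n} → IsSCD n F → ∀ s → s ∈ concat F
  ∈-concat {F = F} (_ , cover) s with proj₁ (cover s)
  ... | l , s∈ = ∈-concat⁺′ s∈ (∈-lookup {xs = F} l)

  once : ∀ {n} {F : SCD n} → IsSCD n F → AtMostOnce F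
  once (_ , cover) s = proj₂ (cover s)

  join-sym : ∀ i {E} → E ∈ pieces i → Sym (Cube (m + n + p)) (m + n + p) (map join E)
  join-sym i E∈ with Piece.sym-E (proj₂ (piece i E∈))
  ... | symmetric {P} {Q} path b = symmetric (map-path join join-⋖ path)
    (trans (cong₂ _+_ (join-rank P) (join-rank Q)) (trans b (sym (+-assoc m n p))))

  D-scd : ∀ i → IsSCD (m + n + p) (D i)
  D-scd i = All.map⁺ (All.tabulate (λ E∈ → Sym⇒symChain (join-sym i E∈))) , λ s → found s , unique⇒atMostOnce (D i) unique s
    where
    scdF = proj₁ (pao 𝓕) i
    scdG = proj₁ (pao 𝓖) i
    scdH = proj₁ (pao ℋ) i
    unique : Unique (concat (D i))
    unique = unique-↭ (↭-sym (D-↭ i)) (Unique.map⁺ join-injective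
      (Unique.cartesianProduct⁺ (SCD⇒unique (F i) (proj₁ scdF) (once scdF))
        (Unique.cartesianProduct⁺ (SCD⇒unique (G i) (proj₁ scdG) (once scdG)) (SCD⇒unique (H i) (proj₁ scdH) (once scdH)))))
    found : ∀ s → Σ (Fin (length (D i))) (λ l → s ∈ lookup (D i) l)
    found s = index at , lookup-index at
      where
      split∈ : split m n p s ∈ concat (F i) ⊠ (concat (G i) ⊠ concat (H i))
      split∈ = ∈-cartesianProduct⁺ (∈-concat scdF _) (∈-cartesianProduct⁺ (∈-concat scdG _) (∈-concat scdH _))
      at : Any (s ∈_) (D i)
      at = ∈-concat⁻ (D i) (∈-resp-↭ (↭-sym (D-↭ i)) (subst (_∈ map join _) (join-split {m} {n} {p} s)
        (∈-map⁺ join split∈)))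

  Below : Carrier Grid → Carrier Grid → Set
  Below (a , b , c) (a′ , b′ , c′) = a ⊆ a′ × b ⊆ b′ × c ⊆ c′

  below-⋖ : ∀ {P Q} → Graded._⋖_ Grid P Q → Below P Q
  below-⋖ (left (e , _))          = e , ⊆-refl , ⊆-refl
  below-⋖ (right (left (e , _)))  = ⊆-refl , e , ⊆-refl
  below-⋖ (right (right (e , _))) = ⊆-refl , ⊆-refl , e

  -- Inclusion rules out the step from the full set down to ∅. Applied to all three coordinates of
  -- comparable points, it makes all jumps go upwards, the only direction that `Separated` controls.
  ordered-meet : ∀ {l} {F G : SCD l} {A B u v} → 1 ≤ l → AlmostOrthogonal F G → A ∈ F → B ∈ G →
                 u ∈ A → u ∈ B → v ∈ A → v ∈ B → u ⊆ v →
                 u ≡ v ⊎ ((HasEnds A × HasEnds B) × Corners u v)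
  ordered-meet {l} 1≤l ao A∈ B∈ uA uB vA vB u⊆v with meet 1≤l ao A∈ B∈ uA uB vA vB
  ... | inj₁ e              = inj₁ e
  ... | inj₂ (h , inj₁ c)   = inj₂ (h , c)
  ... | inj₂ (h , inj₂ (refl , refl)) = ⊥-elim (<-irrefl refl
    (≤-trans 1≤l (≤-trans (≤-reflexive (sym (∣⊤∣≡n l))) (≤-trans (p⊆q⇒∣p∣≤∣q∣ u⊆v) (≤-reflexive (∣⊥∣≡0 l))))))

  shared : ∀ {i j} → i ≢ j → ∀ {cell cell′ E E′ P Q} → Piece i cell E → Piece j cell′ E′ →
           P ∈ E → P ∈ E′ → Q ∈ E → Q ∈ E′ → Below P Q → P ≡ Q ⊎ Corners (join P) (join Q)
  shared {i} {j} i≢j {A , B , C} {A′ , B′ , C′} {E} {E′} {a , b , c} {a′ , b′ , c′} r s P∈E P∈E′ Q∈E Q∈E′ (a⊆ , b⊆ , c⊆)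
    with ∈-cartesianProduct⁻ A _ (Piece.inside r P∈E) | ∈-cartesianProduct⁻ A _ (Piece.inside r Q∈E)
       | ∈-cartesianProduct⁻ A′ _ (Piece.inside s P∈E′) | ∈-cartesianProduct⁻ A′ _ (Piece.inside s Q∈E′)
  ... | aA , bcBC | a′A , b′c′BC | aA′ , bcBC′ | a′A′ , b′c′BC′
    with ∈-cartesianProduct⁻ B C bcBC | ∈-cartesianProduct⁻ B C b′c′BC
       | ∈-cartesianProduct⁻ B′ C′ bcBC′ | ∈-cartesianProduct⁻ B′ C′ b′c′BC′
  ... | bB , cC | b′B , c′C | bB′ , cC′ | b′B′ , c′C′ = go
      (ordered-meet (1≤n 𝓕) (proj₂ (pao 𝓕) i j i≢j) R.A∈ S.A∈ aA aA′ a′A a′A′ a⊆)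
      (ordered-meet (1≤n 𝓖) (proj₂ (pao 𝓖) i j i≢j) R.B∈ S.B∈ bB bB′ b′B b′B′ b⊆)
      (ordered-meet (1≤n ℋ) (proj₂ (pao ℋ) i j i≢j) R.C∈ S.C∈ cC cC′ c′C c′C′ c⊆)
    where
    module R = Piece r
    module S = Piece s
    sepR = R.sep P∈E Q∈E
    sepS = S.sep P∈E′ Q∈E′
    open Separated
    go : a ≡ a′ ⊎ ((HasEnds A × HasEnds A′) × Corners a a′) →
         b ≡ b′ ⊎ ((HasEnds B × HasEnds B′) × Corners b b′) →
         c ≡ c′ ⊎ ((HasEnds C × HasEnds C′) × Corners c c′) →
         (a , b , c) ≡ (a′ , b′ , c′) ⊎ Corners (join (a , b , c)) (join (a′ , b′ , c′))
    go (inj₁ refl) (inj₁ refl) (inj₁ refl) = inj₁ refl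
    -- One jump: both cuts have their exception at the same two fixed coordinates.
    go (inj₂ ((h , h′) , e)) (inj₁ eb) (inj₁ ec) = ⊥-elim
      (thin-conflict 𝓖 ℋ i≢j R.pB S.pB R.pC S.pC R.B∈ S.B∈ R.C∈ S.C∈ bB bB′ cC cC′
        (jump₁ sepR (h , e) eb ec) (jump₁ sepS (h′ , e) eb ec))
    go (inj₁ ea) (inj₂ ((h , h′) , e)) (inj₁ ec) = ⊥-elim
      (thin-conflict 𝓕 ℋ i≢j R.pA S.pA R.pC S.pC R.A∈ S.A∈ R.C∈ S.C∈ aA aA′ cC cC′
        (jump₂ sepR ea (h , e) ec) (jump₂ sepS ea (h′ , e) ec))
    go (inj₁ ea) (inj₁ eb) (inj₂ ((h , h′) , e)) = ⊥-elim
      (thin-conflict 𝓕 𝓖 i≢j R.pA S.pA R.pB S.pB R.A∈ S.A∈ R.B∈ S.B∈ aA aA′ bB bB′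
        (jump₃ sepR ea eb (h , e)) (jump₃ sepS ea eb (h′ , e)))
    -- Two jumps: the third coordinate lies on a singleton chain of both decompositions.
    go (inj₂ ((h , h′) , e)) (inj₂ ((f , f′) , e′)) (inj₁ ec) = ⊥-elim
      (Family.single-conflict ℋ i≢j R.C∈ S.C∈ cC cC′ (jump₁₂ sepR (h , e) (f , e′) ec)
        (≤-trans (≤-reflexive (jump₁₂ sepS (h′ , e) (f′ , e′) ec)) (n≤1+n 1)))
    go (inj₂ ((h , h′) , e)) (inj₁ eb) (inj₂ ((f , f′) , e′)) = ⊥-elim
      (Family.single-conflict 𝓖 i≢j R.B∈ S.B∈ bB bB′ (jump₁₃ sepR (h , e) eb (f , e′))
        (≤-trans (≤-reflexive (jump₁₃ sepS (h′ , e) eb (f′ , e′))) (n≤1+n 1)))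
    go (inj₁ ea) (inj₂ ((h , h′) , e)) (inj₂ ((f , f′) , e′)) = ⊥-elim
      (Family.single-conflict 𝓕 i≢j R.A∈ S.A∈ aA aA′ (jump₂₃ sepR ea (h , e) (f , e′))
        (≤-trans (≤-reflexive (jump₂₃ sepS ea (h′ , e) (f′ , e′))) (n≤1+n 1)))
    -- Three jumps: the points are ∅ and the full set of the product, the one pair that may be
    -- shared.
    go (inj₂ (_ , refl , refl)) (inj₂ (_ , refl , refl)) (inj₂ (_ , refl , refl)) =
      inj₂ (join-constant false m n p , join-constant true m n p)

  D-orthogonal : ∀ i j → i ≢ j → AlmostOrthogonal (D i) (D j)
  D-orthogonal i j i≢j A B A∈ B∈ with ∈-map⁻ (map join) A∈ | ∈-map⁻ (map join) B∈
  ... | E , E∈ , refl | E′ , E′∈ , refl with piece i E∈ | piece j E′∈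
  ... | cell , r | cell′ , s = intersection-size
    (≤-trans (1≤n 𝓕) (≤-trans (m≤m+n m n) (m≤m+n (m + n) p)))
    (path-unique (Sym.path (join-sym i E∈))) key
    where
    key : ∀ {s t} → s ∈ map join E → s ∈ map join E′ → t ∈ map join E → t ∈ map join E′ →
          s ≡ t ⊎ (Corners s t ⊎ Corners t s)
    key sE sE′ tE tE′ with ∈-map⁻ join sE | ∈-map⁻ join sE′ | ∈-map⁻ join tE | ∈-map⁻ join tE′
    ... | P , P∈ , refl | P′ , P′∈ , eP | Q , Q∈ , refl | Q′ , Q′∈ , eQ
      with join-injective {P = P} {P′} eP | join-injective {P = Q} {Q′} eQ
    ... | refl | refl with comparable {R = Below} (⊆-refl , ⊆-refl , ⊆-refl)
                             (λ { (a , b , c) (a′ , b′ , c′) → ⊆-trans a a′ , ⊆-trans b b′ , ⊆-trans c c′ })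
                             below-⋖ (Sym.path (Piece.sym-E r)) P∈ Q∈
    ... | inj₁ P≤Q with shared i≢j r s P∈ P′∈ Q∈ Q′∈ P≤Q
    ...   | inj₁ e = inj₁ (cong join e)
    ...   | inj₂ c = inj₂ (inj₁ c)
    key sE sE′ tE tE′ | P , P∈ , refl | P′ , P′∈ , eP | Q , Q∈ , refl | Q′ , Q′∈ , eQ | refl | refl | inj₂ Q≤P
      with shared i≢j r s Q∈ Q′∈ P∈ P′∈ Q≤P
    ...   | inj₁ e = inj₁ (cong join (sym e))
    ...   | inj₂ c = inj₂ (inj₂ c)

  D-inside : ∀ i → All (λ Dc → Σ _ λ A → Σ _ λ B → Σ _ λ C →
                     (A ∈ F i) × (B ∈ G i) × (C ∈ H i) × InCuboid {m} {n} {p} Dc A B C) (D i)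
  D-inside i = All.map⁺ (All.tabulate λ {E} E∈ → inside (piece i E∈))
    where
    inside : ∀ {E} → (∃ λ cell → Piece i cell E) → _
    inside ((A , B , C) , r) = A , B , C , Piece.A∈ r , Piece.B∈ r , Piece.C∈ r ,
      All.map⁺ (All.tabulate λ {P} P∈ →
        subst (λ Q → proj₁ Q ∈ A × proj₁ (proj₂ Q) ∈ B × proj₂ (proj₂ Q) ∈ C) (sym (split-join {m} {n} {p} P))
          (map₂ (∈-cartesianProduct⁻ B C) (∈-cartesianProduct⁻ A _ (Piece.inside r P∈))))

  result : Σ (Fin k → SCD (m + n + p)) λ D →
    IsPAOFamily (m + n + p) k D ×
    (∀ i → All (λ Dc → Σ _ λ A → Σ _ λ B → Σ _ λ C →
      (A ∈ F i) × (B ∈ G i) × (C ∈ H i) × InCuboid {m} {n} {p} Dc A B C) (D i))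
  result = D , (D-scd , D-orthogonal) , D-inside

theorem6p1 : (m n p k : ℕ) → 2 ≤ m → 2 ≤ n → 2 ≤ p → 3 ≤ k →
    (F : Fin k → SCD m) (G : Fin k → SCD n) (H : Fin k → SCD p) →
    IsPAOFamily m k F → IsPAOFamily n k G → IsPAOFamily p k H →
    ((Good m k F × Good n k G × (Good p k H ⊎ Odd p)) ⊎
    (Good m k F × Good p k H × (Good n k G ⊎ Odd n)) ⊎
    (Good n k G × Good p k H × (Good m k F ⊎ Odd m))) →
    Σ (Fin k → SCD (m + n + p)) λ D →
    IsPAOFamily (m + n + p) k D ×
    (∀ i → All (λ Dc → Σ _ λ A → Σ _ λ B → Σ _ λ C →
    (A ∈ F i) × (B ∈ G i) × (C ∈ H i) × InCuboid {m} {n} {p} Dc A B C)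
    (D i))
theorem6p1 m n p k 2≤m 2≤n 2≤p 3≤k F G H paoF paoG paoH = λ
  { (inj₁ (f , g , h))        → Combine.result (family F paoF 2≤m 0 z≤n (inj₁ f)) (family G paoG 2≤n 1 (s≤s z≤n) (inj₁ g))
                                  (family H paoH 2≤p 2 ≤-refl (last h)) (λ ()) (λ ()) (λ ())
  ; (inj₂ (inj₁ (f , h , g))) → Combine.result (family F paoF 2≤m 0 z≤n (inj₁ f)) (family G paoG 2≤n 2 ≤-refl (last g))
                                  (family H paoH 2≤p 1 (s≤s z≤n) (inj₁ h)) (λ ()) (λ ()) (λ ())
  ; (inj₂ (inj₂ (g , h , f))) → Combine.result (family F paoF 2≤m 2 ≤-refl (last f)) (family G paoG 2≤n 0 z≤n (inj₁ g))
                                  (family H paoH 2≤p 1 (s≤s z≤n) (inj₁ h)) (λ ()) (λ ()) (λ ())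
  }
  where
  family : ∀ {l} (F : Fin k → SCD l) → IsPAOFamily l k F → 2 ≤ l → ∀ r → r ≤ 2 → Good l k F ⊎ (Odd l × r ≡ 2) → Family l k F
  family F paoF 2≤l r r≤2 g = record
    { 4≤n = dimension≥4 paoF 2≤l 3≤k ; pao = paoF ; priority = r ; prio≤2 = r≤2 ; good = g }
  last : ∀ {l} {F : Fin k → SCD l} → Good l k F ⊎ Odd l → Good l k F ⊎ (Odd l × 2 ≡ 2)
  last (inj₁ g) = inj₁ g
  last (inj₂ o) = inj₂ (o , refl)
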